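{- For every $0\le k\le \binom n2$, $$R_k\cong\bigoplus_{S} R_{\lambda_S}$$ as $S_n$-modules, where the sum is over all subsets $S\subseteq[n-1]$ with $\sum_{i\in S} i=k$.
   Context: $P_n=\mathbf{Q}[x_1,\dots,x_n]$ with $S_n$ acting by permuting variables ($\tau(x_i)=x_{\tau(i)}$). $I_n$ is the ideal generated by the symmetric polynomials without constant term; $P_n/I_n$ is the coinvariant algebra, $\psi:P_n\to P_n/I_n$ the canonical projection, and $R_k$ its $k$-th homogeneous component. For a monomial $m=\prod x_i^{p_i}$, its exponent partition $\lambda(m)$ is $(p_1,\dots,p_n)$ rearranged in weakly decreasing order. For a partition $\lambda$ with at most $n$ parts, $P^{\trianglelefteq}_\lambda$ (resp. $P^{\triangleleft}_\lambda$) is the $\mathbf{Q}$-span of monomials $m$ with $\lambda(m)$ dominated by $\lambda$ (resp. strictly dominated by $\lambda$) in dominance order, and $R_\lambda:=\psi(P^{\trianglelefteq}_\lambda)/\psi(P^{\triangleleft}_\lambda)$, an $S_n$-module. For $S\subseteq[n]$, $\lambda_S=(\lambda_1,\dots,\lambda_n)$ with $\lambda_i=|S\cap\{i,\dots,n\}|$. -}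

module Defs where

open import Data.Nat as ℕ using (ℕ; zero; suc; _≤_)
open import Data.Nat.Properties using (≤-decTotalOrder)
open import Data.Nat.ListAction using () renaming (sum to sumℕ)
open import Data.Rational as ℚ using (ℚ; 0ℚ)
open import Data.Bool using (Bool; true; false)
open import Data.Fin using (Fin)
open import Data.Fin.Permutation using (Permutation′; _⟨$⟩ˡ_)
open import Data.Vec as Vec using (Vec; []; _∷_; lookup; tabulate; replicate; zipWith)
open import Data.Vec.Properties using (≡-dec)
open import Data.List as List using (List; []; _∷_; take; reverse; concatMap)
open import Data.List.Relation.Unary.All using (All)
open import Data.List.Sort.InsertionSort.Base ≤-decTotalOrder using (sort)
open import Data.Product using (Σ; ∃; _×_; _,_; proj₁; proj₂)
open import Data.Unit using (⊤)
open import Relation.Binary.PropositionalEquality using (_≡_; _≢_)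
open import Relation.Nullary using (¬_; yes; no)

Monomial : ℕ → Set
Monomial n = Vec ℕ n

-- a polynomial, represented by a finite formal list of terms c·m
-- (equality of polynomials is _≈P_ below, comparing all coefficients)
Poly : ℕ → Set
Poly n = List (ℚ × Monomial n)

coeff : ∀ {n} → Poly n → Monomial n → ℚ
coeff [] m = 0ℚ
coeff ((c , m′) ∷ p) m with ≡-dec ℕ._≟_ m′ m
... | yes _ = c ℚ.+ coeff p m
... | no  _ = coeff p m

infix 4 _≈P_
_≈P_ : ∀ {n} → Poly n → Poly n → Set
p ≈P q = ∀ m → coeff p m ≡ coeff q m

infixl 6 _+P_ _-P_
infixl 7 _*P_

_+P_ : ∀ {n} → Poly n → Poly n → Poly n
p +P q = p List.++ q

_·P_ : ∀ {n} → ℚ → Poly n → Poly n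
c ·P p = List.map (λ t → (c ℚ.* proj₁ t , proj₂ t)) p

-P_ : ∀ {n} → Poly n → Poly n
-P p = (ℚ.- ℚ.1ℚ) ·P p

_-P_ : ∀ {n} → Poly n → Poly n → Poly n
p -P q = p +P (-P q)

_*P_ : ∀ {n} → Poly n → Poly n → Poly n
p *P q = concatMap (λ s → List.map (λ t → (proj₁ s ℚ.* proj₁ t , zipWith ℕ._+_ (proj₂ s) (proj₂ t))) q) p

0P : ∀ {n} → Poly n
0P = []

sumP : ∀ {n} → List (Poly n) → Poly n
sumP = List.foldr _+P_ 0P

-- The S_n action: τ(x_i) = x_{τ(i)}.  So τ sends ∏ x_i^{p_i} to
-- ∏ x_{τ(i)}^{p_i}, whose exponent at position j is p_{τ⁻¹(j)}.

actM : ∀ {n} → Permutation′ n → Monomial n → Monomial n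
actM τ m = tabulate (λ j → lookup m (τ ⟨$⟩ˡ j))

act : ∀ {n} → Permutation′ n → Poly n → Poly n
act τ p = List.map (λ t → (proj₁ t , actM τ (proj₂ t))) p

Symmetric : ∀ {n} → Poly n → Set
Symmetric {n} f = (τ : Permutation′ n) → act τ f ≈P f

NoConstantTerm : ∀ {n} → Poly n → Set
NoConstantTerm {n} f = coeff f (replicate n 0) ≡ 0ℚ

InI : ∀ {n} → Poly n → Set
InI {n} p = Σ (List (Poly n × Poly n)) λ gfs →
  All (λ gf → Symmetric (proj₂ gf) × NoConstantTerm (proj₂ gf)) gfs ×
  (p ≈P sumP (List.map (λ gf → proj₁ gf *P proj₂ gf) gfs))

degree : ∀ {n} → Monomial n → ℕ
degree = Vec.sum

Homogeneous : ∀ {n} → ℕ → Poly n → Set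
Homogeneous k p = ∀ m → coeff p m ≢ 0ℚ → degree m ≡ k

-- Partitions and dominance order (partitions with n parts, padded by 0)

expPartition : ∀ {n} → Monomial n → List ℕ
expPartition m = reverse (sort (Vec.toList m))

_⊴_ : List ℕ → List ℕ → Set
μ ⊴ lam = (sumℕ μ ≡ sumℕ lam) × (∀ j → sumℕ (take j μ) ≤ sumℕ (take j lam))

_◁_ : List ℕ → List ℕ → Set
μ ◁ lam = (μ ⊴ lam) × (μ ≢ lam)

InPDom : ∀ {n} → List ℕ → Poly n → Set
InPDom lam p = ∀ m → coeff p m ≢ 0ℚ → expPartition m ⊴ lam

InPStrict : ∀ {n} → List ℕ → Poly n → Set
InPStrict lam p = ∀ m → coeff p m ≢ 0ℚ → expPartition m ◁ lam

-- The S_n-modules, as carriers with equivalence relations on representatives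

-- R_k = ψ(P_k) ⊆ P_n/I_n : represented by homogeneous polynomials of
-- degree k, with ψ(p) = ψ(q) iff p - q ∈ I_n
Rk : ℕ → ℕ → Set
Rk n k = Σ (Poly n) (Homogeneous k)

_∼I_ : ∀ {n} → Poly n → Poly n → Set
p ∼I q = InI (p -P q)

-- R_λ = ψ(P^⊴_λ)/ψ(P^◁_λ) : represented by elements of P^⊴_λ, with
-- [p] = [q] iff ψ(p) - ψ(q) ∈ ψ(P^◁_λ), i.e. p - q - r ∈ I_n for some r ∈ P^◁_λ
Rλ : ℕ → List ℕ → Set
Rλ n lam = Σ (Poly n) (InPDom lam)

Rel-λ : ∀ {n} → List ℕ → Poly n → Poly n → Set
Rel-λ {n} lam p q = Σ (Poly n) λ r → InPStrict lam r × InI (p -P q -P r)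

-- Subsets S ⊆ [n] as Vec Bool n (position i-1 ↔ element i)

Subset : ℕ → Set
Subset n = Vec Bool n

count : ∀ {n} → Subset n → ℕ
count [] = 0
count (true ∷ S) = suc (count S)
count (false ∷ S) = count S

lamS : ∀ {n} → Subset n → List ℕ
lamS [] = []
lamS (b ∷ S) = count (b ∷ S) ∷ lamS S

-- Σ_{i ∈ S} i, where the head position has label `off + 1`
weightFrom : ∀ {n} → ℕ → Subset n → ℕ
weightFrom off [] = 0
weightFrom off (true ∷ S) = suc off ℕ.+ weightFrom (suc off) S
weightFrom off (false ∷ S) = weightFrom (suc off) S

weight : ∀ {n} → Subset n → ℕ
weight = weightFrom 0

-- S ⊆ [n-1], i.e. n ∉ S
AvoidsLast : ∀ {n} → Subset n → Set
AvoidsLast [] = ⊤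
AvoidsLast (b ∷ []) = b ≡ false
AvoidsLast (b ∷ c ∷ S) = AvoidsLast (c ∷ S)

Index : ℕ → ℕ → Set
Index n k = Σ (Subset n) λ S → AvoidsLast S × (weight S ≡ k)

DirectSum : ℕ → ℕ → Set
DirectSum n k = (s : Index n k) → Rλ n (lamS (proj₁ s))

_∼⊕_ : ∀ {n k} → (Index n k → Poly n) → (Index n k → Poly n) → Set
_∼⊕_ {n} {k} x y = (s : Index n k) → Rel-λ (lamS (proj₁ s)) (x s) (y s)

pr : ∀ {n k} → DirectSum n k → Index n k → Poly n
pr x s = proj₁ (x s)

-- S_n-module isomorphism R_k ≅ ⊕_S R_{λ_S}: a map on representatives
-- that is well defined, ℚ-linear, S_n-equivariant, injective and
-- surjective (all modulo the respective equivalence relations).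
-- Linearity/equivariance are stated for any representative r of the
-- sum / scalar multiple / translate.

record IsSnIso (n k : ℕ) (F : Rk n k → DirectSum n k) : Set where
  field
    well-defined : ∀ p q → proj₁ p ∼I proj₁ q → pr (F p) ∼⊕ pr (F q)
    additive     : ∀ p q r → proj₁ r ≈P proj₁ p +P proj₁ q →
                   pr (F r) ∼⊕ (λ s → pr (F p) s +P pr (F q) s)
    homogeneous  : ∀ c p r → proj₁ r ≈P c ·P proj₁ p →
                   pr (F r) ∼⊕ (λ s → c ·P pr (F p) s)
    equivariant  : ∀ (τ : Permutation′ n) p r → proj₁ r ≈P act τ (proj₁ p) →
                   pr (F r) ∼⊕ (λ s → act τ (pr (F p) s))
    injective    : ∀ p q → pr (F p) ∼⊕ pr (F q) → proj₁ p ∼I proj₁ q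
    surjective   : ∀ (y : DirectSum n k) → Σ (Rk n k) λ p → pr (F p) ∼⊕ pr y

Rk≅⊕Rλ : ℕ → ℕ → Set
Rk≅⊕Rλ n k = Σ (Rk n k → DirectSum n k) (IsSnIso n k)

{-# OPTIONS --safe #-}
module Submission where

-- Let d(m) be the descent monomial with the same order of exponents as m (ties
-- broken by index), and let e be its quotient m/d(m).  Among the terms of d(m)
-- times the orbit sum of e, the monomial m has the dominant exponent partition
-- and, by the rearrangement inequality, the strictly largest value of a numerical
-- rank.  Hence these products form a basis of P_n triangular to the monomials;
-- those with e ≠ 1 span I_n, so reduction to descent monomials is well defined
-- modulo I_n, and it only lowers exponent partitions.  Averaging the reduction
-- over S_n gives an equivariant map, whose homogeneous parts of shape λ_S are
-- the components R_k → R_{λ_S}.  Up to the factor n!, their sum is unitriangular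
-- for the dominance order, hence bijective.

open import Defs
open import Axiom.UniquenessOfIdentityProofs using (module Decidable⇒UIP)
open import Algebra.Bundles using (CommutativeRing)
import Algebra.Properties.CommutativeSemigroup as CommutativeSemigroupₚ
open import Data.Bool using (true; false)
import Data.Bool.Properties as Boolₚ
open import Data.Empty using (⊥)
open import Data.Fin as Fin using (Fin; zero; suc; toℕ; punchIn)
open import Data.Fin.Permutation as Perm
  using (Permutation′; permutation; _⟨$⟩ˡ_; _⟨$⟩ʳ_; _∘ₚ_; flip; insert; remove)
import Data.Fin.Properties as Finₚ
open import Data.Integer using (+<+)
open import Data.List as List
  using (List; []; _∷_; _++_; allFin; applyDownFrom; concatMap; filter; length; map; reverse; take)
open import Data.List.Membership.Propositional using (_∈_)
open import Data.List.Membership.Propositional.Properties using (∈-allFin; ∈-map⁺)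
open import Data.List.Membership.Propositional.Properties.WithK using (unique∧set⇒bag)
open import Data.List.Properties
  using (length-applyDownFrom; length-filter; length-map; length-tabulate; map-cong; map-cong-local;
         map-tabulate; map-∘; unfold-reverse; ∷-injective)
  renaming (≡-dec to List-≡-dec)
open import Data.List.Relation.Binary.BagAndSetEquality using (∼bag⇒↭)
open import Data.List.Relation.Binary.Permutation.Propositional
  using (_↭_; ↭-refl; ↭-sym; ↭-trans; ↭⇒↭ₛ)
open import Data.List.Relation.Binary.Permutation.Propositional.Properties
  using (drop-∷; ↭-empty-inv; ↭-length; ↭-reverse; ∈-resp-↭)
  renaming (map⁺ to ↭-map⁺)
import Data.List.Relation.Binary.Permutation.Setoid.Properties as ↭ₛ
open import Data.List.Relation.Unary.All as All using (All; []; _∷_)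
import Data.List.Relation.Unary.All.Properties as Allₚ
open import Data.List.Relation.Unary.AllPairs as AllPairs using (AllPairs; []; _∷_)
import Data.List.Relation.Unary.AllPairs.Properties as AllPairsₚ
open import Data.List.Relation.Unary.Any as Any using (Any; here; there)
import Data.List.Relation.Unary.Any.Properties as Anyₚ
open import Data.List.Relation.Unary.Linked as Linked using (Linked; []; [-]; _∷_)
open import Data.List.Relation.Unary.Linked.Properties using (AllPairs⇒Linked; Linked⇒AllPairs)
open import Data.List.Relation.Unary.Unique.Propositional using (Unique)
import Data.List.Relation.Unary.Unique.Propositional.Properties as Uniqueₚ
open import Data.List.Sort.Base using (SortingAlgorithm)
import Data.List.Sort.InsertionSort as InsertionSort
open import Data.Nat as ℕ using (ℕ; zero; suc; z≤n; s≤s; _≤_; _<_; _>_; _≥_; _+_; _*_; _∸_)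
open import Data.Nat.Combinatorics using (_C_)
open import Data.Nat.Induction using (<-rec; <-wellFounded)
open import Data.Nat.ListAction using () renaming (sum to sumℕ)
open import Data.Nat.ListAction.Properties using (sum-↭)
open import Data.Nat.Properties as ℕₚ using (≤-decTotalOrder)
open import Data.Nat.Tactic.RingSolver using (solve-∀)
open import Data.Product using (Σ; ∃; _×_; _,_; proj₁; proj₂)
open import Data.Rational as ℚ using (ℚ; 0ℚ; 1ℚ)
import Data.Rational.Properties as ℚₚ
open import Data.Rational.Solver using (module +-*-Solver)
open import Data.Sum using (_⊎_; inj₁; inj₂)
open import Data.Unit using (tt)
open import Data.Vec as Vec using ([]; _∷_; lookup; replicate; tabulate; toList; zipWith)
open import Data.Vec.Properties
  using (lookup-replicate; lookup-zipWith; lookup∘tabulate; tabulate-cong; tabulate∘lookup; zipWith-assoc)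
  renaming (≡-dec to Vec-≡-dec)
open import Function using (_∘_; mk⇔)
open import Induction.WellFounded using (Acc; acc)
open import Relation.Binary.Bundles using (DecTotalOrder)
import Relation.Binary.Construct.Flip.EqAndOrd as Flip
import Relation.Binary.Construct.On as On
open import Relation.Binary.Definitions using (tri<; tri≈; tri>)
open import Relation.Binary.PropositionalEquality
  using (_≡_; _≢_; refl; sym; trans; cong; cong₂; subst; setoid; module ≡-Reasoning)
open import Relation.Nullary using (¬_; ¬?; Dec; does; yes; no; contradiction; _×-dec_)

-- Dominance alone cannot drive the reduction: distinct monomials of one exponent partition can
-- occur in the same product, already in x_1 + x_2, which arises from m = x_1 in two variables.
-- `rank` separates them. Up to a constant depending only on n, n times `rank m` is the squared
-- length of the vector `key m`; permuting a factor therefore changes it through a scalar product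
-- whose weights are pairwise distinct. Dominance is moreover only partial, so the inductions over
-- partitions use `level`, a number strictly monotone for it.
--
-- Averaging is forced by equivariance: the span of the descent monomials is in general not stable
-- under the action, so `red` does not commute with it.
--
-- The diagonal factor is n! because each σ (red (σ⁻¹ t)) is congruent to t modulo I_n, and the
-- coordinates `topCoeff` used to compare elements of R_λ vanish on I_n as well as on all monomials
-- strictly below λ.

private
  variable
    n k : ℕ
    A B : Set

-- Polynomials and linear functionals

_≟M_ : (m m′ : Monomial n) → Dec (m ≡ m′)
_≟M_ = Vec-≡-dec ℕ._≟_

infixl 6 _⊕_
_⊕_ : Monomial n → Monomial n → Monomial n
_⊕_ = zipWith ℕ._+_

eval : (Monomial n → ℚ) → Poly n → ℚ
eval h []            = 0ℚ
eval h ((c , m) ∷ p) = c ℚ.* h m ℚ.+ eval h p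

-- Equality after every linear functional: this makes all operations on
-- polynomials compute, without reference to individual coefficients.
infix 4 _≋_
_≋_ : Poly n → Poly n → Set
p ≋ q = ∀ h → eval h p ≡ eval h q

+-interchange : ∀ a b c d → (a ℚ.+ b) ℚ.+ (c ℚ.+ d) ≡ (a ℚ.+ c) ℚ.+ (b ℚ.+ d)
+-interchange = CommutativeSemigroupₚ.interchange (CommutativeRing.+-commutativeSemigroup ℚₚ.+-*-commutativeRing)

*-leftComm : ∀ a b c → a ℚ.* (b ℚ.* c) ≡ b ℚ.* (a ℚ.* c)
*-leftComm = CommutativeSemigroupₚ.x∙yz≈y∙xz (CommutativeRing.*-commutativeSemigroup ℚₚ.+-*-commutativeRing)

+-leftComm : ∀ a b c → a ℚ.+ (b ℚ.+ c) ≡ b ℚ.+ (a ℚ.+ c)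
+-leftComm = CommutativeSemigroupₚ.x∙yz≈y∙xz (CommutativeRing.+-commutativeSemigroup ℚₚ.+-*-commutativeRing)

eval-cong : ∀ {h h′ : Monomial n → ℚ} → (∀ m → h m ≡ h′ m) → ∀ p → eval h p ≡ eval h′ p
eval-cong eq []            = refl
eval-cong eq ((c , m) ∷ p) = cong₂ ℚ._+_ (cong (c ℚ.*_) (eq m)) (eval-cong eq p)

eval-++ : ∀ (h : Monomial n → ℚ) p q → eval h (p ++ q) ≡ eval h p ℚ.+ eval h q
eval-++ h []            q = sym (ℚₚ.+-identityˡ _)
eval-++ h ((c , m) ∷ p) q =
  trans (cong (c ℚ.* h m ℚ.+_) (eval-++ h p q)) (sym (ℚₚ.+-assoc (c ℚ.* h m) _ _))

eval-· : ∀ (h : Monomial n → ℚ) c p → eval h (c ·P p) ≡ c ℚ.* eval h p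
eval-· h c []            = sym (ℚₚ.*-zeroʳ c)
eval-· h c ((d , m) ∷ p) =
  trans (cong₂ ℚ._+_ (ℚₚ.*-assoc c d (h m)) (eval-· h c p)) (sym (ℚₚ.*-distribˡ-+ c _ _))

-1*x : ∀ x → (ℚ.- 1ℚ) ℚ.* x ≡ ℚ.- x
-1*x x = trans (sym (ℚₚ.neg-distribˡ-* 1ℚ x)) (cong ℚ.-_ (ℚₚ.*-identityˡ x))

eval-- : ∀ (h : Monomial n → ℚ) p q → eval h (p -P q) ≡ eval h p ℚ.- eval h q
eval-- h p q = trans (eval-++ h p (-P q))
  (cong (eval h p ℚ.+_) (trans (eval-· h (ℚ.- 1ℚ) q) (-1*x _)))

eval-+h : ∀ (h h′ : Monomial n → ℚ) p → eval (λ m → h m ℚ.+ h′ m) p ≡ eval h p ℚ.+ eval h′ p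
eval-+h h h′ []            = sym (ℚₚ.+-identityˡ 0ℚ)
eval-+h h h′ ((c , m) ∷ p) =
  trans (cong₂ ℚ._+_ (ℚₚ.*-distribˡ-+ c (h m) (h′ m)) (eval-+h h h′ p)) (+-interchange (c ℚ.* h m) (c ℚ.* h′ m) (eval h p) (eval h′ p))

eval-*h : ∀ c (h : Monomial n → ℚ) p → eval (λ m → c ℚ.* h m) p ≡ c ℚ.* eval h p
eval-*h c h []            = sym (ℚₚ.*-zeroʳ c)
eval-*h c h ((d , m) ∷ p) =
  trans (cong₂ ℚ._+_ (*-leftComm d c (h m)) (eval-*h c h p)) (sym (ℚₚ.*-distribˡ-+ c _ _))

eval-0h : ∀ (p : Poly n) → eval (λ _ → 0ℚ) p ≡ 0ℚ
eval-0h p = trans (eval-cong (λ _ → sym (ℚₚ.*-zeroˡ 0ℚ)) p)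
  (trans (eval-*h 0ℚ (λ _ → 0ℚ) p) (ℚₚ.*-zeroˡ (eval (λ _ → 0ℚ) p)))

eval-act : ∀ (h : Monomial n → ℚ) τ p → eval h (act τ p) ≡ eval (h ∘ actM τ) p
eval-act h τ []            = refl
eval-act h τ ((c , m) ∷ p) = cong (c ℚ.* h (actM τ m) ℚ.+_) (eval-act h τ p)

lin : (Monomial n → Poly n) → Poly n → Poly n
lin f = concatMap (λ t → proj₁ t ·P f (proj₂ t))

eval-lin : ∀ (h : Monomial n → ℚ) f p → eval h (lin f p) ≡ eval (λ m → eval h (f m)) p
eval-lin h f []            = refl
eval-lin h f ((c , m) ∷ p) =
  trans (eval-++ h (c ·P f m) (lin f p)) (cong₂ ℚ._+_ (eval-· h c (f m)) (eval-lin h f p))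

eval-*P : ∀ (h : Monomial n → ℚ) p q →
  eval h (p *P q) ≡ eval (λ s → eval (λ t → h (s ⊕ t)) q) p
eval-*P h []            q = refl
eval-*P h ((c , s) ∷ p) q =
  trans (eval-++ h (List.map _ q) (p *P q)) (cong₂ ℚ._+_ (scaled q) (eval-*P h p q))
  where
  scaled : ∀ q → eval h (List.map (λ t → (c ℚ.* proj₁ t , s ⊕ proj₂ t)) q)
                 ≡ c ℚ.* eval (λ t → h (s ⊕ t)) q
  scaled []            = sym (ℚₚ.*-zeroʳ c)
  scaled ((d , t) ∷ q) =
    trans (cong₂ ℚ._+_ (ℚₚ.*-assoc c d _) (scaled q)) (sym (ℚₚ.*-distribˡ-+ c _ _))

mono : Monomial n → Poly n
mono m = (1ℚ , m) ∷ []

eval-mono : ∀ (h : Monomial n → ℚ) m → eval h (mono m) ≡ h m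
eval-mono h m = trans (ℚₚ.+-identityʳ _) (ℚₚ.*-identityˡ _)

δ : Monomial n → Monomial n → ℚ
δ m m′ with m′ ≟M m
... | yes _ = 1ℚ
... | no  _ = 0ℚ

δ-≢ : ∀ (m m′ : Monomial n) → m′ ≢ m → δ m m′ ≡ 0ℚ
δ-≢ m m′ ne with m′ ≟M m
... | yes eq = contradiction eq ne
... | no  _  = refl

δ-refl : ∀ (m : Monomial n) → δ m m ≡ 1ℚ
δ-refl m with m ≟M m
... | yes _  = refl
... | no  ne = contradiction refl ne

coeff-eval : ∀ (p : Poly n) m → coeff p m ≡ eval (δ m) p
coeff-eval []             m = refl
coeff-eval ((c , m′) ∷ p) m with m′ ≟M m
... | yes _ = cong₂ ℚ._+_ (sym (ℚₚ.*-identityʳ c)) (coeff-eval p m)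
... | no  _ = trans (coeff-eval p m)
  (sym (trans (cong (ℚ._+ eval (δ m) p) (ℚₚ.*-zeroʳ c)) (ℚₚ.+-identityˡ _)))

≋⇒≈P : ∀ {p q : Poly n} → p ≋ q → p ≈P q
≋⇒≈P {p = p} {q} eq m = trans (coeff-eval p m) (trans (eq (δ m)) (sym (coeff-eval q m)))

without : Monomial n → Poly n → Poly n
without m = filter (λ t → ¬? (proj₂ t ≟M m))

eval-without : ∀ (h : Monomial n → ℚ) m p →
  eval h p ≡ coeff p m ℚ.* h m ℚ.+ eval h (without m p)
eval-without h m [] = sym (trans (ℚₚ.+-identityʳ _) (ℚₚ.*-zeroˡ (h m)))
eval-without h m ((c , m′) ∷ p) with m′ ≟M m
... | yes refl = begin
  c ℚ.* h m ℚ.+ eval h p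
    ≡⟨ cong (c ℚ.* h m ℚ.+_) (eval-without h m p) ⟩
  c ℚ.* h m ℚ.+ (coeff p m ℚ.* h m ℚ.+ eval h (without m p))
    ≡⟨ ℚₚ.+-assoc (c ℚ.* h m) _ _ ⟨
  (c ℚ.* h m ℚ.+ coeff p m ℚ.* h m) ℚ.+ eval h (without m p)
    ≡⟨ cong (ℚ._+ eval h (without m p)) (ℚₚ.*-distribʳ-+ (h m) c (coeff p m)) ⟨
  (c ℚ.+ coeff p m) ℚ.* h m ℚ.+ eval h (without m p) ∎
  where open ≡-Reasoning
... | no _ = trans (cong (c ℚ.* h m′ ℚ.+_) (eval-without h m p))
  (+-leftComm (c ℚ.* h m′) (coeff p m ℚ.* h m) (eval h (without m p)))

coeff-without : ∀ (p : Poly n) m m′ → coeff (without m p) m′ ≢ 0ℚ → coeff p m′ ≢ 0ℚ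
coeff-without p m m′ ne eq with m ≟M m′
... | yes refl = ne (same p)
  where
  same : ∀ p → coeff (without m p) m ≡ 0ℚ
  same [] = refl
  same ((c , x) ∷ p) with x ≟M m
  ... | yes _ = same p
  ... | no x≢m with x ≟M m
  ...   | yes x≡m = contradiction x≡m x≢m
  ...   | no  _   = same p
... | no m≢m′ = ne (trans (other p) eq)
  where
  other : ∀ p → coeff (without m p) m′ ≡ coeff p m′
  other [] = refl
  other ((c , x) ∷ p) with x ≟M m
  other ((c , x) ∷ p) | yes refl with x ≟M m′
  ... | yes x≡m′ = contradiction x≡m′ m≢m′
  ... | no  _    = other p
  other ((c , x) ∷ p) | no _ with x ≟M m′
  ... | yes _ = cong (c ℚ.+_) (other p)
  ... | no  _ = other p

-- Only the coefficient function of p matters: all terms with the monomial of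
-- the first term are collected at once, and the rest is a shorter list.
eval-supp : ∀ {h h′ : Monomial n → ℚ} p → (∀ m → coeff p m ≢ 0ℚ → h m ≡ h′ m) →
  eval h p ≡ eval h′ p
eval-supp {n} {h} {h′} p eq = go p eq (<-wellFounded (length p))
  where
  go : ∀ p → (∀ m → coeff p m ≢ 0ℚ → h m ≡ h′ m) → Acc _<_ (length p) → eval h p ≡ eval h′ p
  go []             eq _         = refl
  go ((c , m) ∷ q′) eq (acc rec) = begin
    eval h q                                     ≡⟨ eval-without h m q ⟩
    coeff q m ℚ.* h m ℚ.+ eval h (without m q)   ≡⟨ cong₂ ℚ._+_ head-eq tail-eq ⟩
    coeff q m ℚ.* h′ m ℚ.+ eval h′ (without m q) ≡⟨ eval-without h′ m q ⟨
    eval h′ q                                    ∎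
    where
    open ≡-Reasoning
    q : Poly n
    q = (c , m) ∷ q′
    head-eq : coeff q m ℚ.* h m ≡ coeff q m ℚ.* h′ m
    head-eq with coeff q m ℚₚ.≟ 0ℚ
    ... | yes e = trans (cong (ℚ._* h m) e)
                    (trans (trans (ℚₚ.*-zeroˡ (h m)) (sym (ℚₚ.*-zeroˡ (h′ m)))) (cong (ℚ._* h′ m) (sym e)))
    ... | no  e = cong (coeff q m ℚ.*_) (eq m e)
    shorter : length (without m q) < length q
    shorter with m ≟M m
    ... | yes _  = s≤s (length-filter (λ t → ¬? (proj₂ t ≟M m)) q′)
    ... | no  ne = contradiction refl ne
    tail-eq : eval h (without m q) ≡ eval h′ (without m q)
    tail-eq = go (without m q) (λ x e → eq x (coeff-without q m x e)) (rec shorter)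

eval-supp0 : ∀ {h : Monomial n → ℚ} p → (∀ m → coeff p m ≢ 0ℚ → h m ≡ 0ℚ) → eval h p ≡ 0ℚ
eval-supp0 p eq = trans (eval-supp p eq) (eval-0h p)

x-y≡0⇒x≡y : ∀ x y → x ℚ.- y ≡ 0ℚ → x ≡ y
x-y≡0⇒x≡y x y e = begin
  x                       ≡⟨ ℚₚ.+-identityʳ x ⟨
  x ℚ.+ 0ℚ                ≡⟨ cong (x ℚ.+_) (ℚₚ.+-inverseˡ y) ⟨
  x ℚ.+ (ℚ.- y ℚ.+ y)     ≡⟨ ℚₚ.+-assoc x (ℚ.- y) y ⟨
  (x ℚ.- y) ℚ.+ y         ≡⟨ cong (ℚ._+ y) e ⟩
  0ℚ ℚ.+ y                ≡⟨ ℚₚ.+-identityˡ y ⟩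
  y                       ∎
  where open ≡-Reasoning

x≡y⇒x-y≡0 : ∀ {x y} → x ≡ y → x ℚ.- y ≡ 0ℚ
x≡y⇒x-y≡0 {x} refl = ℚₚ.+-inverseʳ x

-- The lists may differ in order and in cancelling terms, but their difference has empty support, so
-- `eval-supp0` applies vacuously.
≈P⇒≋ : ∀ {p q : Poly n} → p ≈P q → p ≋ q
≈P⇒≋ {p = p} {q} eq h = x-y≡0⇒x≡y _ _
  (trans (sym (eval-- h p q)) (eval-supp0 (p -P q) (λ m ne → contradiction (zeroCoeff m) ne)))
  where
  zeroCoeff : ∀ m → coeff (p -P q) m ≡ 0ℚ
  zeroCoeff m = trans (coeff-eval (p -P q) m) (trans (eval-- (δ m) p q)
    (x≡y⇒x-y≡0 (trans (sym (coeff-eval p m)) (trans (eq m) (coeff-eval q m)))))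

coeff--≢0 : ∀ (p q : Poly n) m → coeff (p -P q) m ≢ 0ℚ → coeff p m ≢ 0ℚ ⊎ coeff q m ≢ 0ℚ
coeff--≢0 p q m ne with coeff p m ℚₚ.≟ 0ℚ | coeff q m ℚₚ.≟ 0ℚ
... | no np  | _      = inj₁ np
... | yes _  | no nq  = inj₂ nq
... | yes zp | yes zq = contradiction (trans (coeff-eval (p -P q) m) (trans (eval-- (δ m) p q)
  (cong₂ ℚ._-_ (trans (sym (coeff-eval p m)) zp) (trans (sym (coeff-eval q m)) zq)))) ne

-- Sums over the symmetric group

Σ⟨_⟩ : List A → (A → ℚ) → ℚ
Σ⟨ xs ⟩ f = List.foldr (λ x s → f x ℚ.+ s) 0ℚ xs

Σ-cong : ∀ {f g : A → ℚ} → (∀ x → f x ≡ g x) → ∀ xs → Σ⟨ xs ⟩ f ≡ Σ⟨ xs ⟩ g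
Σ-cong eq []       = refl
Σ-cong eq (x ∷ xs) = cong₂ ℚ._+_ (eq x) (Σ-cong eq xs)

Σ-++ : ∀ (f : A → ℚ) xs ys → Σ⟨ xs ++ ys ⟩ f ≡ Σ⟨ xs ⟩ f ℚ.+ Σ⟨ ys ⟩ f
Σ-++ f []       ys = sym (ℚₚ.+-identityˡ _)
Σ-++ f (x ∷ xs) ys = trans (cong (f x ℚ.+_) (Σ-++ f xs ys)) (sym (ℚₚ.+-assoc (f x) _ _))

Σ-map : ∀ (f : B → ℚ) (g : A → B) xs → Σ⟨ map g xs ⟩ f ≡ Σ⟨ xs ⟩ (f ∘ g)
Σ-map f g []       = refl
Σ-map f g (x ∷ xs) = cong (f (g x) ℚ.+_) (Σ-map f g xs)

Σ-concatMap : ∀ (f : B → ℚ) (g : A → List B) xs →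
  Σ⟨ concatMap g xs ⟩ f ≡ Σ⟨ xs ⟩ (λ x → Σ⟨ g x ⟩ f)
Σ-concatMap f g []       = refl
Σ-concatMap f g (x ∷ xs) =
  trans (Σ-++ f (g x) _) (cong (Σ⟨ g x ⟩ f ℚ.+_) (Σ-concatMap f g xs))

Σ-+ : ∀ (f g : A → ℚ) xs → Σ⟨ xs ⟩ (λ x → f x ℚ.+ g x) ≡ Σ⟨ xs ⟩ f ℚ.+ Σ⟨ xs ⟩ g
Σ-+ f g []       = sym (ℚₚ.+-identityˡ 0ℚ)
Σ-+ f g (x ∷ xs) =
  trans (cong (f x ℚ.+ g x ℚ.+_) (Σ-+ f g xs)) (+-interchange (f x) (g x) _ _)

Σ-* : ∀ c (f : A → ℚ) xs → Σ⟨ xs ⟩ (λ x → c ℚ.* f x) ≡ c ℚ.* Σ⟨ xs ⟩ f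
Σ-* c f []       = sym (ℚₚ.*-zeroʳ c)
Σ-* c f (x ∷ xs) =
  trans (cong (c ℚ.* f x ℚ.+_) (Σ-* c f xs)) (sym (ℚₚ.*-distribˡ-+ c _ _))

Σ-const : ∀ c (xs : List A) → Σ⟨ xs ⟩ (λ _ → c) ≡ Σ⟨ xs ⟩ (λ _ → 1ℚ) ℚ.* c
Σ-const c xs = trans (Σ-cong (λ _ → sym (ℚₚ.*-identityʳ c)) xs)
  (trans (Σ-* c (λ _ → 1ℚ) xs) (ℚₚ.*-comm c _))

Σ-0 : ∀ (xs : List A) → Σ⟨ xs ⟩ (λ _ → 0ℚ) ≡ 0ℚ
Σ-0 xs = trans (Σ-const 0ℚ xs) (ℚₚ.*-zeroʳ (Σ⟨ xs ⟩ (λ _ → 1ℚ)))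

Σ-swap : ∀ (f : A → B → ℚ) xs ys →
  Σ⟨ xs ⟩ (λ x → Σ⟨ ys ⟩ (f x)) ≡ Σ⟨ ys ⟩ (λ y → Σ⟨ xs ⟩ (λ x → f x y))
Σ-swap f []       ys = sym (Σ-0 ys)
Σ-swap f (x ∷ xs) ys =
  trans (cong (Σ⟨ ys ⟩ (f x) ℚ.+_) (Σ-swap f xs ys)) (sym (Σ-+ (f x) _ ys))

Σ-↭ : ∀ (f : A → ℚ) {xs ys} → xs ↭ ys → Σ⟨ xs ⟩ f ≡ Σ⟨ ys ⟩ f
Σ-↭ f _↭_.refl          = refl
Σ-↭ f (_↭_.prep x p)    = cong (f x ℚ.+_) (Σ-↭ f p)
Σ-↭ f (_↭_.swap x y p)  =
  trans (cong (λ s → f x ℚ.+ (f y ℚ.+ s)) (Σ-↭ f p)) (+-leftComm (f x) (f y) _)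
Σ-↭ f (_↭_.trans p q)   = trans (Σ-↭ f p) (Σ-↭ f q)

Σ-eval : ∀ (h : A → Monomial n → ℚ) xs p →
  Σ⟨ xs ⟩ (λ x → eval (h x) p) ≡ eval (λ m → Σ⟨ xs ⟩ (λ x → h x m)) p
Σ-eval h []       p = sym (eval-0h p)
Σ-eval h (x ∷ xs) p = trans (cong (eval (h x) p ℚ.+_) (Σ-eval h xs p)) (sym (eval-+h (h x) _ p))

eval-concatMap : ∀ (h : Monomial n → ℚ) (φ : A → Poly n) xs →
  eval h (concatMap φ xs) ≡ Σ⟨ xs ⟩ (λ x → eval h (φ x))
eval-concatMap h φ []       = refl
eval-concatMap h φ (x ∷ xs) =
  trans (eval-++ h (φ x) _) (cong (eval h (φ x) ℚ.+_) (eval-concatMap h φ xs))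

Σ-nonneg : ∀ {f : A → ℚ} → (∀ x → 0ℚ ℚ.≤ f x) → ∀ xs → 0ℚ ℚ.≤ Σ⟨ xs ⟩ f
Σ-nonneg nn []       = ℚₚ.≤-refl
Σ-nonneg nn (x ∷ xs) = ℚₚ.+-mono-≤ (nn x) (Σ-nonneg nn xs)

Σ-pos : ∀ {f : A → ℚ} → (∀ x → 0ℚ ℚ.≤ f x) → ∀ {xs} → Any (λ x → 0ℚ ℚ.< f x) xs → 0ℚ ℚ.< Σ⟨ xs ⟩ f
Σ-pos nn {x ∷ xs} (here pos)  = ℚₚ.+-mono-<-≤ pos (Σ-nonneg nn xs)
Σ-pos nn {x ∷ xs} (there any) = ℚₚ.+-mono-≤-< (nn x) (Σ-pos nn any)

unique∧complete⇒↭allFin : ∀ {xs : List (Fin n)} → Unique xs → (∀ i → i ∈ xs) → xs ↭ allFin n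
unique∧complete⇒↭allFin {n} u all = ∼bag⇒↭ (unique∧set⇒bag u (Uniqueₚ.allFin⁺ n)
  (mk⇔ (λ _ → ∈-allFin _) (λ _ → all _)))

injective∧surjective⇒↭allFin : ∀ (f g : Fin n → Fin n) → (∀ i → g (f i) ≡ i) → (∀ i → f (g i) ≡ i) →
  map f (allFin n) ↭ allFin n
injective∧surjective⇒↭allFin {n} f g gf fg = unique∧complete⇒↭allFin
  (Uniqueₚ.map⁺ (λ {i} {j} e → trans (sym (gf i)) (trans (cong g e) (gf j))) (Uniqueₚ.allFin⁺ n))
  (λ i → subst (_∈ map f (allFin n)) (fg i) (∈-map⁺ f (∈-allFin (g i))))

-- Recursion on the image `j` of `zero`. Later arguments reach this list through translation
-- invariance of its sums and through its containing the identity.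
perms : ∀ n → List (Permutation′ n)
perms zero    = Perm.id ∷ []
perms (suc n) = concatMap (λ j → map (insert zero j) (perms n)) (allFin (suc n))

-- Identities between composites of permutations hold only pointwise, so summands over the group
-- have to respect `Perm.≈`.
Extensional : (Permutation′ n → ℚ) → Set
Extensional f = ∀ σ ρ → σ Perm.≈ ρ → f σ ≡ f ρ

insert-cong : ∀ (j : Fin (suc n)) {π ρ : Permutation′ n} → π Perm.≈ ρ →
  insert zero j π Perm.≈ insert zero j ρ
insert-cong j eq zero    = refl
insert-cong j eq (suc k) = cong (punchIn j) (eq k)

insert-∘ : ∀ (j : Fin (suc n)) (π : Permutation′ n) (τ : Permutation′ (suc n)) →
  insert zero j π ∘ₚ τ Perm.≈ insert zero (τ ⟨$⟩ʳ j) (π ∘ₚ remove j τ)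
insert-∘ j π τ zero    = refl
insert-∘ j π τ (suc k) = Perm.punchIn-permute τ j (π ⟨$⟩ʳ k)

Σ-perms-suc : ∀ (f : Permutation′ (suc n) → ℚ) →
  Σ⟨ perms (suc n) ⟩ f ≡ Σ⟨ allFin (suc n) ⟩ (λ j → Σ⟨ perms n ⟩ (λ π → f (insert zero j π)))
Σ-perms-suc {n} f = trans (Σ-concatMap f (λ j → map (insert zero j) (perms n)) (allFin (suc n)))
  (Σ-cong (λ j → Σ-map f (insert zero j) (perms n)) (allFin (suc n)))

-- By `insert-∘`, the image `j` of `zero` moves to `τ ⟨$⟩ʳ j` while the remaining permutation is
-- composed with `remove j τ`. Induction absorbs the latter, and `τ` merely reorders the outer sum.
Σ-postcompose : ∀ (f : Permutation′ n → ℚ) → Extensional f → ∀ τ →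
  Σ⟨ perms n ⟩ (λ σ → f (σ ∘ₚ τ)) ≡ Σ⟨ perms n ⟩ f
Σ-postcompose {zero}  f ext τ = cong (ℚ._+ 0ℚ) (ext (Perm.id ∘ₚ τ) Perm.id (λ ()))
Σ-postcompose {suc n} f ext τ = begin
  Σ⟨ perms (suc n) ⟩ (λ σ → f (σ ∘ₚ τ))
    ≡⟨ Σ-perms-suc (λ σ → f (σ ∘ₚ τ)) ⟩
  Σ⟨ allFin (suc n) ⟩ (λ j → Σ⟨ perms n ⟩ (λ π → f (insert zero j π ∘ₚ τ)))
    ≡⟨ Σ-cong (λ j → Σ-cong (λ π → ext _ _ (insert-∘ j π τ)) (perms n)) (allFin (suc n)) ⟩
  Σ⟨ allFin (suc n) ⟩ (λ j → Σ⟨ perms n ⟩ (λ π → f (insert zero (τ ⟨$⟩ʳ j) (π ∘ₚ remove j τ))))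
    ≡⟨ Σ-cong (λ j → Σ-postcompose (λ π → f (insert zero (τ ⟨$⟩ʳ j) π))
                       (λ π ρ eq → ext _ _ (insert-cong (τ ⟨$⟩ʳ j) {π} {ρ} eq)) (remove j τ)) (allFin (suc n)) ⟩
  Σ⟨ allFin (suc n) ⟩ (λ j → g (τ ⟨$⟩ʳ j))
    ≡⟨ Σ-map g (τ ⟨$⟩ʳ_) (allFin (suc n)) ⟨
  Σ⟨ map (τ ⟨$⟩ʳ_) (allFin (suc n)) ⟩ g
    ≡⟨ Σ-↭ g (injective∧surjective⇒↭allFin (τ ⟨$⟩ʳ_) (τ ⟨$⟩ˡ_)
               (λ i → Perm.inverseˡ τ) (λ i → Perm.inverseʳ τ)) ⟩
  Σ⟨ allFin (suc n) ⟩ g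
    ≡⟨ Σ-perms-suc f ⟨
  Σ⟨ perms (suc n) ⟩ f ∎
  where
  open ≡-Reasoning
  g : Fin (suc n) → ℚ
  g j = Σ⟨ perms n ⟩ (λ π → f (insert zero j π))

perms∋id : ∀ n → Any (Perm.id Perm.≈_) (perms n)
perms∋id zero    = here (λ ())
perms∋id (suc n) = Anyₚ.++⁺ˡ (Anyₚ.map⁺ (Any.map lift (perms∋id n)))
  where
  lift : ∀ {π : Permutation′ n} → Perm.id Perm.≈ π → Perm.id Perm.≈ insert zero zero π
  lift eq zero    = refl
  lift eq (suc k) = cong suc (eq k)

Σ-perms-pos : ∀ (f : Permutation′ n → ℚ) → Extensional f → (∀ σ → 0ℚ ℚ.≤ f σ) →
  0ℚ ℚ.< f Perm.id → 0ℚ ℚ.< Σ⟨ perms n ⟩ f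
Σ-perms-pos {n} f ext nn pos = Σ-pos nn
  (Any.map (λ {σ} eq → subst (0ℚ ℚ.<_) (ext Perm.id σ eq) pos) (perms∋id n))

0<1 : 0ℚ ℚ.< 1ℚ
0<1 = ℚ.*<* (+<+ (s≤s z≤n))

n!ℚ : ℕ → ℚ
n!ℚ n = Σ⟨ perms n ⟩ (λ _ → 1ℚ)

n!ℚ≢0 : ∀ n → n!ℚ n ≢ 0ℚ
n!ℚ≢0 n eq = ℚₚ.<⇒≢ (Σ-perms-pos {n} (λ _ → 1ℚ) (λ _ _ _ → refl) (λ _ → ℚₚ.<⇒≤ 0<1) 0<1) (sym eq)

inv : (s : ℚ) → s ≢ 0ℚ → ℚ
inv s s≢0 = ℚ.1/_ s {{ℚ.≢-nonZero s≢0}}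

inv-* : ∀ s (s≢0 : s ≢ 0ℚ) x → inv s s≢0 ℚ.* (s ℚ.* x) ≡ x
inv-* s s≢0 x = trans (sym (ℚₚ.*-assoc (inv s s≢0) s x))
  (trans (cong (ℚ._* x) (ℚₚ.*-inverseˡ s {{ℚ.≢-nonZero s≢0}})) (ℚₚ.*-identityˡ x))

*-cancelˡ : ∀ {s} → s ≢ 0ℚ → ∀ {x y} → s ℚ.* x ≡ s ℚ.* y → x ≡ y
*-cancelˡ {s} s≢0 {x} {y} eq =
  trans (sym (inv-* s s≢0 x)) (trans (cong (inv s s≢0 ℚ.*_) eq) (inv-* s s≢0 y))

flip-cong : ∀ (σ ρ : Permutation′ n) → σ Perm.≈ ρ → flip σ Perm.≈ flip ρ
flip-cong σ ρ eq i = begin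
  σ ⟨$⟩ˡ i                         ≡⟨ cong (σ ⟨$⟩ˡ_) (Perm.inverseʳ ρ) ⟨
  σ ⟨$⟩ˡ (ρ ⟨$⟩ʳ (ρ ⟨$⟩ˡ i))       ≡⟨ cong (σ ⟨$⟩ˡ_) (eq _) ⟨
  σ ⟨$⟩ˡ (σ ⟨$⟩ʳ (ρ ⟨$⟩ˡ i))       ≡⟨ Perm.inverseˡ σ ⟩
  ρ ⟨$⟩ˡ i                         ∎
  where open ≡-Reasoning

-- Evaluate Σ_ρ Σ_σ f(ρ⁻¹σ) in both orders, using only invariance under
-- left translation.
Σ-flip : ∀ (f : Permutation′ n → ℚ) → Extensional f →
  Σ⟨ perms n ⟩ (λ σ → f (flip σ)) ≡ Σ⟨ perms n ⟩ f
Σ-flip {n} f ext = *-cancelˡ (n!ℚ≢0 n) (sym (begin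
  n!ℚ n ℚ.* Σ⟨ perms n ⟩ f
    ≡⟨ Σ-const _ (perms n) ⟨
  Σ⟨ perms n ⟩ (λ ρ → Σ⟨ perms n ⟩ f)
    ≡⟨ Σ-cong (λ ρ → Σ-postcompose f ext (flip ρ)) (perms n) ⟨
  Σ⟨ perms n ⟩ (λ ρ → Σ⟨ perms n ⟩ (λ σ → f (σ ∘ₚ flip ρ)))
    ≡⟨ Σ-swap (λ ρ σ → f (σ ∘ₚ flip ρ)) (perms n) (perms n) ⟩
  Σ⟨ perms n ⟩ (λ σ → Σ⟨ perms n ⟩ (λ ρ → f (σ ∘ₚ flip ρ)))
    ≡⟨ Σ-cong (λ σ → Σ-postcompose (λ ρ → f (flip ρ)) (λ σ ρ eq → ext _ _ (flip-cong σ ρ eq)) (flip σ)) (perms n) ⟩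
  Σ⟨ perms n ⟩ (λ σ → Σ⟨ perms n ⟩ (λ ρ → f (flip ρ)))
    ≡⟨ Σ-const _ (perms n) ⟩
  n!ℚ n ℚ.* Σ⟨ perms n ⟩ (λ σ → f (flip σ)) ∎))
  where open ≡-Reasoning

-- Inversion turns translation on one side into translation on the other.
Σ-precompose : ∀ (f : Permutation′ n → ℚ) → Extensional f → ∀ τ →
  Σ⟨ perms n ⟩ (λ σ → f (τ ∘ₚ σ)) ≡ Σ⟨ perms n ⟩ f
Σ-precompose {n} f ext τ = begin
  Σ⟨ perms n ⟩ (λ σ → f (τ ∘ₚ σ))
    ≡⟨ Σ-flip (λ σ → f (τ ∘ₚ σ)) (λ σ ρ eq → ext _ _ (λ i → eq (τ ⟨$⟩ʳ i))) ⟨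
  Σ⟨ perms n ⟩ (λ σ → f (τ ∘ₚ flip σ))
    ≡⟨ Σ-postcompose (λ σ → f (flip σ)) (λ σ ρ eq → ext _ _ (flip-cong σ ρ eq)) (flip τ) ⟩
  Σ⟨ perms n ⟩ (λ σ → f (flip σ))
    ≡⟨ Σ-flip f ext ⟩
  Σ⟨ perms n ⟩ f ∎
  where open ≡-Reasoning

-- The action on monomials

0ᴹ : Monomial n
0ᴹ {n} = replicate n 0

lookup-ext : ∀ {m m′ : Monomial n} → (∀ i → lookup m i ≡ lookup m′ i) → m ≡ m′
lookup-ext {m = m} {m′} eq = trans (sym (tabulate∘lookup m)) (trans (tabulate-cong eq) (tabulate∘lookup m′))

lookup-actM : ∀ τ (m : Monomial n) i → lookup (actM τ m) i ≡ lookup m (τ ⟨$⟩ˡ i)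
lookup-actM τ m i = lookup∘tabulate _ i

actM-cong : ∀ (σ ρ : Permutation′ n) → σ Perm.≈ ρ → ∀ m → actM σ m ≡ actM ρ m
actM-cong σ ρ eq m = tabulate-cong (λ i → cong (lookup m) (flip-cong σ ρ eq i))

actM-∘ : ∀ σ τ (m : Monomial n) → actM (σ ∘ₚ τ) m ≡ actM τ (actM σ m)
actM-∘ σ τ m = tabulate-cong (λ i → sym (lookup-actM σ m (τ ⟨$⟩ˡ i)))

actM-id : ∀ (m : Monomial n) → actM Perm.id m ≡ m
actM-id m = tabulate∘lookup m

actM-flipˡ : ∀ τ (m : Monomial n) → actM (flip τ) (actM τ m) ≡ m
actM-flipˡ τ m = lookup-ext (λ i → trans (lookup-actM (flip τ) (actM τ m) i)
  (trans (lookup-actM τ m _) (cong (lookup m) (Perm.inverseˡ τ))))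

actM-flipʳ : ∀ τ (m : Monomial n) → actM τ (actM (flip τ) m) ≡ m
actM-flipʳ τ m = lookup-ext (λ i → trans (lookup-actM τ (actM (flip τ) m) i)
  (trans (lookup-actM (flip τ) m _) (cong (lookup m) (Perm.inverseʳ τ))))

actM-⊕ : ∀ τ (s t : Monomial n) → actM τ (s ⊕ t) ≡ actM τ s ⊕ actM τ t
actM-⊕ τ s t = lookup-ext (λ i → begin
  lookup (actM τ (s ⊕ t)) i                          ≡⟨ lookup-actM τ (s ⊕ t) i ⟩
  lookup (s ⊕ t) (τ ⟨$⟩ˡ i)                          ≡⟨ lookup-zipWith ℕ._+_ _ s t ⟩
  lookup s (τ ⟨$⟩ˡ i) ℕ.+ lookup t (τ ⟨$⟩ˡ i)        ≡⟨ cong₂ ℕ._+_ (lookup-actM τ s i) (lookup-actM τ t i) ⟨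
  lookup (actM τ s) i ℕ.+ lookup (actM τ t) i        ≡⟨ lookup-zipWith ℕ._+_ i (actM τ s) (actM τ t) ⟨
  lookup (actM τ s ⊕ actM τ t) i                     ∎)
  where open ≡-Reasoning

actM-0 : ∀ τ → actM τ (0ᴹ {n}) ≡ 0ᴹ
actM-0 τ = lookup-ext (λ i → trans (lookup-actM τ 0ᴹ i)
  (trans (lookup-replicate (τ ⟨$⟩ˡ i) 0) (sym (lookup-replicate i 0))))

-- Sorted lists and the dominance order

sorted-unique : ∀ {R : A → A → Set} → (∀ {x y} → R x y → R y x → x ≡ y) →
  ∀ {xs ys} → AllPairs R xs → AllPairs R ys → xs ↭ ys → xs ≡ ys
sorted-unique anti []       sys p = sym (↭-empty-inv (↭-sym p))
sorted-unique anti (_∷_ {x} rx sxs) [] p with () ← ↭-empty-inv p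
sorted-unique {R = R} anti (_∷_ {x} {xs} rx sxs) (_∷_ {y} {ys} ry sys) p =
  tails (heads (∈-resp-↭ p (here refl)) (∈-resp-↭ (↭-sym p) (here refl))) sys p
  where
  heads : x ∈ y ∷ ys → y ∈ x ∷ xs → x ≡ y
  heads (here e)  _         = e
  heads (there _) (here e)  = sym e
  heads (there a) (there b) = anti (All.lookup rx b) (All.lookup ry a)
  tails : ∀ {y ys} → x ≡ y → AllPairs R ys → x ∷ xs ↭ y ∷ ys → x ∷ xs ≡ y ∷ ys
  tails refl sys p = cong (x ∷_) (sorted-unique anti sxs sys (drop-∷ p))

Descending : List ℕ → Set
Descending = AllPairs _≥_

descending-unique : ∀ {xs ys} → Descending xs → Descending ys → xs ↭ ys → xs ≡ ys
descending-unique = sorted-unique (λ a b → ℕₚ.≤-antisym b a)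

≥-decTotalOrder : DecTotalOrder _ _ _
≥-decTotalOrder = Flip.decTotalOrder ≤-decTotalOrder

module Sort≥ = InsertionSort ≥-decTotalOrder
module Sort≥ₚ = SortingAlgorithm Sort≥.insertionSort
module Sort≤ₚ = SortingAlgorithm (InsertionSort.insertionSort ≤-decTotalOrder)

sort≥-descending : ∀ xs → Descending (Sort≥.sort xs)
sort≥-descending xs = Linked⇒AllPairs (λ a b → ℕₚ.≤-trans b a) (Sort≥ₚ.sort-↗ xs)

prefix : ℕ → List ℕ → ℕ
prefix j xs = sumℕ (take j xs)

-- Insertion moves `x` past larger entries only; each exchange brings the larger entry forward, so
-- no prefix sum drops.
prefix-insert : ∀ j x xs → prefix j (x ∷ xs) ≤ prefix j (Sort≥.insert x xs)
prefix-insert j       x []       = ℕₚ.≤-refl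
prefix-insert zero    x (y ∷ xs) = z≤n
prefix-insert (suc j) x (y ∷ xs) with y ℕ.≤? x in eq
... | yes y≤x rewrite cong does eq = ℕₚ.≤-refl
... | no  y≰x rewrite cong does eq = swapped j
  where
  x≤y : x ≤ y
  x≤y = ℕₚ.<⇒≤ (ℕₚ.≰⇒> y≰x)
  swapped : ∀ j → x + prefix j (y ∷ xs) ≤ y + prefix j (Sort≥.insert x xs)
  swapped zero    = ℕₚ.+-monoˡ-≤ 0 x≤y
  swapped (suc j) = begin
    x + (y + prefix j xs)                  ≡⟨ leftComm x y (prefix j xs) ⟩
    y + (x + prefix j xs)                  ≤⟨ ℕₚ.+-monoʳ-≤ y (prefix-insert (suc j) x xs) ⟩
    y + prefix (suc j) (Sort≥.insert x xs) ∎
    where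
    open ℕₚ.≤-Reasoning
    leftComm : ∀ a b c → a + (b + c) ≡ b + (a + c)
    leftComm = solve-∀

prefix-sort : ∀ j xs → prefix j xs ≤ prefix j (Sort≥.sort xs)
prefix-sort j       []       = ℕₚ.≤-refl
prefix-sort zero    (x ∷ xs) = z≤n
prefix-sort (suc j) (x ∷ xs) =
  ℕₚ.≤-trans (ℕₚ.+-monoʳ-≤ x (prefix-sort j xs)) (prefix-insert (suc j) x (Sort≥.sort xs))

-- Sorting gives the bound for one descending rearrangement, and uniqueness of that rearrangement
-- carries it over to `ys`.
prefix-↭ : ∀ {xs ys} → Descending ys → xs ↭ ys → ∀ j → prefix j xs ≤ prefix j ys
prefix-↭ {xs} dys p j = subst (λ l → prefix j xs ≤ prefix j l)
  (descending-unique (sort≥-descending xs) dys (↭-trans (Sort≥ₚ.sort-↭ xs) p)) (prefix-sort j xs)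

reverse-AllPairs : ∀ {R : A → A → Set} {xs} → AllPairs R xs → AllPairs (λ x y → R y x) (reverse xs)
reverse-AllPairs [] = []
reverse-AllPairs {R = R} {x ∷ xs} (rx ∷ rxs) rewrite unfold-reverse x xs =
  AllPairsₚ.++⁺ (reverse-AllPairs rxs) ([] ∷ [])
    (All.tabulate (λ y∈ → All.lookup rx (∈-resp-↭ (↭-reverse xs) y∈) ∷ []))

expPartition-descending : ∀ (m : Monomial n) → Descending (expPartition m)
expPartition-descending m = reverse-AllPairs
  (Linked⇒AllPairs ℕₚ.≤-trans (Sort≤ₚ.sort-↗ (toList m)))

expPartition-↭ : ∀ (m : Monomial n) → expPartition m ↭ toList m
expPartition-↭ m = ↭-trans (↭-reverse _) (Sort≤ₚ.sort-↭ (toList m))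

expPartition-unique : ∀ (m : Monomial n) {xs} → Descending xs → xs ↭ toList m → expPartition m ≡ xs
expPartition-unique m dxs p =
  descending-unique (expPartition-descending m) dxs (↭-trans (expPartition-↭ m) (↭-sym p))

dot : List ℕ → List ℕ → ℕ
dot (x ∷ xs) (y ∷ ys) = x * y + dot xs ys
dot _        _        = 0

-- Summation by parts: c is the surplus of prefix sums carried over from the
-- entries already consumed, to be paid at the (larger) weight h.
dot-abel : ∀ h c α β β′ → AllPairs _>_ (h ∷ α) → length β ≡ length α → length β′ ≡ length α →
  (∀ j → prefix j β′ ≤ c + prefix j β) → sumℕ β′ ≡ c + sumℕ β →
  (c ≡ 0 × β′ ≡ β) ⊎ dot α β′ < h * c + dot α β
dot-abel h c []      []      []        dec lb lb′ pre tot =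
  inj₁ (trans (sym (ℕₚ.+-identityʳ c)) (sym tot) , refl)
dot-abel h c (x ∷ α) (b ∷ β) (b′ ∷ β′) ((h>x ∷ _) ∷ dec) lb lb′ pre tot =
  conclude (dot-abel x c′ α β β′ dec (ℕₚ.suc-injective lb) (ℕₚ.suc-injective lb′) pre′ tot′)
  where
  b′≤ : b′ ≤ c + b
  b′≤ = begin
    b′           ≡⟨ ℕₚ.+-identityʳ b′ ⟨
    b′ + 0       ≤⟨ pre 1 ⟩
    c + (b + 0)  ≡⟨ cong (c +_) (ℕₚ.+-identityʳ b) ⟩
    c + b        ∎
    where open ℕₚ.≤-Reasoning
  c′ = c + b ℕ.∸ b′
  carry : b′ + c′ ≡ c + b
  carry = ℕₚ.m+[n∸m]≡n b′≤
  regroup : ∀ s → c + (b + s) ≡ b′ + (c′ + s)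
  regroup s = trans (sym (ℕₚ.+-assoc c b s)) (trans (cong (_+ s) (sym carry)) (ℕₚ.+-assoc b′ c′ s))
  pre′ : ∀ j → prefix j β′ ≤ c′ + prefix j β
  pre′ j = ℕₚ.+-cancelˡ-≤ b′ _ _ (ℕₚ.≤-trans (pre (suc j)) (ℕₚ.≤-reflexive (regroup (prefix j β))))
  tot′ : sumℕ β′ ≡ c′ + sumℕ β
  tot′ = ℕₚ.+-cancelˡ-≡ b′ _ _ (trans tot (regroup (sumℕ β)))
  collect : x * b′ + (x * c′ + dot α β) ≡ x * c + (x * b + dot α β)
  collect = trans (distrib x b′ c′ _) (trans (cong (λ k → x * k + dot α β) carry) (sym (distrib x c b _)))
    where
    distrib : ∀ x a b d → x * a + (x * b + d) ≡ x * (a + b) + d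
    distrib = solve-∀
  xc≤hc : x * c + (x * b + dot α β) ≤ h * c + (x * b + dot α β)
  xc≤hc = ℕₚ.+-monoˡ-≤ _ (ℕₚ.*-monoˡ-≤ c (ℕₚ.<⇒≤ h>x))
  conclude : (c′ ≡ 0 × β′ ≡ β) ⊎ dot α β′ < x * c′ + dot α β →
    (c ≡ 0 × b′ ∷ β′ ≡ b ∷ β) ⊎ x * b′ + dot α β′ < h * c + (x * b + dot α β)
  conclude (inj₂ lt) = inj₂ (ℕₚ.<-≤-trans (ℕₚ.+-monoʳ-< (x * b′) lt)
    (ℕₚ.≤-trans (ℕₚ.≤-reflexive collect) xc≤hc))
  conclude (inj₁ (c′≡0 , refl)) with c ℕ.≟ 0
  ... | yes refl = inj₁ (refl , cong (_∷ β)
    (trans (sym (trans (cong (b′ +_) c′≡0) (ℕₚ.+-identityʳ b′))) carry))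
  ... | no  c≢0 = inj₂ (begin-strict
    x * b′ + dot α β                 ≤⟨ ℕₚ.+-monoʳ-≤ (x * b′) (ℕₚ.m≤n+m (dot α β) (x * c′)) ⟩
    x * b′ + (x * c′ + dot α β)      ≡⟨ collect ⟩
    x * c + (x * b + dot α β)        <⟨ ℕₚ.+-monoˡ-< _ (ℕₚ.*-monoˡ-< c {{ℕ.≢-nonZero c≢0}} h>x) ⟩
    h * c + (x * b + dot α β)        ∎)
    where open ℕₚ.≤-Reasoning

dot-dominance : ∀ α β β′ → AllPairs _>_ α → length β ≡ length α → length β′ ≡ length α →
  (∀ j → prefix j β′ ≤ prefix j β) → sumℕ β′ ≡ sumℕ β → β′ ≡ β ⊎ dot α β′ < dot α β
dot-dominance α β β′ dec lb lb′ pre tot =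
  -- The extra weight only has to exceed every entry of `α`; with initial surplus 0 its contribution
  -- vanishes.
  conclude (dot-abel (suc (sumℕ α)) 0 α β β′ (bounded α ∷ dec) lb lb′ pre tot)
  where
  bounded : ∀ α → All (suc (sumℕ α) >_) α
  bounded []      = []
  bounded (x ∷ α) = s≤s (ℕₚ.m≤m+n x _) ∷
    All.map (λ y< → ℕₚ.<-≤-trans y< (s≤s (ℕₚ.m≤n+m _ x))) (bounded α)
  conclude : (0 ≡ 0 × β′ ≡ β) ⊎ dot α β′ < suc (sumℕ α) * 0 + dot α β → β′ ≡ β ⊎ dot α β′ < dot α β
  conclude (inj₁ (_ , eq)) = inj₁ eq
  conclude (inj₂ lt)       = inj₂ (subst (λ k → dot α β′ < k + dot α β) (ℕₚ.*-zeroʳ (suc (sumℕ α))) lt)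

⊴-refl : ∀ {μ} → μ ⊴ μ
⊴-refl = refl , λ _ → ℕₚ.≤-refl

⊴-trans : ∀ {μ ν κ} → μ ⊴ ν → ν ⊴ κ → μ ⊴ κ
⊴-trans (e , p) (e′ , p′) = trans e e′ , λ j → ℕₚ.≤-trans (p j) (p′ j)

-- The weights are n, n - 1, ..., 1, so this is the sum of all prefix sums, which makes it strictly
-- monotone for dominance.
height : List ℕ → ℕ
height μ = dot (applyDownFrom suc (length μ)) μ

⊴⇒≡⊎height< : ∀ {μ ν} → length μ ≡ length ν → μ ⊴ ν → μ ≡ ν ⊎ height μ < height ν
⊴⇒≡⊎height< {μ} {ν} eq (tot , pre) rewrite eq =
  dot-dominance (applyDownFrom suc (length ν)) ν μ
    (AllPairsₚ.applyDownFrom⁺₁ suc (length ν) (λ j<i _ → s≤s j<i))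
    (sym (length-applyDownFrom suc (length ν))) (trans eq (sym (length-applyDownFrom suc (length ν))))
    pre tot

-- Descent monomials

-- Comparing keys n·mᵢ + (n - 1 - i) orders positions by decreasing exponent,
-- ties broken by increasing index.
tie : Fin n → ℕ
tie {n} i = n ∸ suc (toℕ i)

key : Monomial n → Fin n → ℕ
key {n} m i = n * lookup m i + tie i

Before : Monomial n → Fin n → Fin n → Set
Before m i j = key m i > key m j

-- The least amount by which the exponent at `i` must exceed that at `j` for `i` to come before `j`:
-- 1 if the index goes down from `i` to `j`, else 0.
descent : Fin n → Fin n → ℕ
descent i j with j Fin.<? i
... | yes _ = 1
... | no  _ = 0

tie<n : (i : Fin n) → tie i < n
tie<n i = ℕₚ.∸-monoʳ-< (s≤s z≤n) (Finₚ.toℕ<n i)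

tie-anti : ∀ {i j : Fin n} → i Fin.< j → tie j < tie i
tie-anti {j = j} i<j = ℕₚ.∸-monoʳ-< (s≤s i<j) (Finₚ.toℕ<n j)

key-< : ∀ (m : Monomial n) i j → lookup m j < lookup m i → key m j < key m i
key-< {n} m i j lt = begin-strict
  n * lookup m j + tie j  <⟨ ℕₚ.+-monoʳ-< (n * lookup m j) (tie<n j) ⟩
  n * lookup m j + n      ≡⟨ ℕₚ.+-comm _ n ⟩
  n + n * lookup m j      ≡⟨ ℕₚ.*-suc n _ ⟨
  n * suc (lookup m j)    ≤⟨ ℕₚ.*-monoʳ-≤ n lt ⟩
  n * lookup m i          ≤⟨ ℕₚ.m≤m+n _ _ ⟩
  n * lookup m i + tie i  ∎
  where open ℕₚ.≤-Reasoning

key-tie : ∀ (m : Monomial n) i j → lookup m j ≤ lookup m i → i Fin.< j → key m j < key m i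
key-tie {n} m i j le i<j = ℕₚ.+-mono-≤-< (ℕₚ.*-monoʳ-≤ n le) (tie-anti i<j)

-- Together with `descent⇒before`, this makes a comparison of keys linear in the exponents, so that
-- it can be added to and subtracted from.
before⇒descent : ∀ (m : Monomial n) i j → Before m i j → descent i j + lookup m j ≤ lookup m i
before⇒descent m i j b with j Fin.<? i
... | yes j<i = ℕₚ.≰⇒> (λ le → ℕₚ.<-asym b (key-tie m j i le j<i))
... | no  _   = ℕₚ.≮⇒≥ (λ lt → ℕₚ.<-asym b (key-< m j i lt))

descent⇒before : ∀ (m : Monomial n) i j → i ≢ j → descent i j + lookup m j ≤ lookup m i → Before m i j
descent⇒before m i j i≢j le with j Fin.<? i
... | yes _   = key-< m i j le
... | no  j≮i = key-tie m i j le (Finₚ.≤∧≢⇒< (ℕₚ.≮⇒≥ j≮i) i≢j)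

before-total : ∀ (m : Monomial n) i j → i ≢ j → Before m i j ⊎ Before m j i
before-total m i j i≢j with ℕₚ.<-cmp (lookup m i) (lookup m j)
... | tri< lt _ _ = inj₂ (key-< m j i lt)
... | tri> _ _ gt = inj₁ (key-< m i j gt)
... | tri≈ _ eq _ with Finₚ.<-cmp i j
...   | tri< i<j _ _ = inj₁ (key-tie m i j (ℕₚ.≤-reflexive (sym eq)) i<j)
...   | tri≈ _ i≡j _ = contradiction i≡j i≢j
...   | tri> _ _ j<i = inj₂ (key-tie m j i (ℕₚ.≤-reflexive eq) j<i)

keyOrder : Monomial n → DecTotalOrder _ _ _
keyOrder m = On.decTotalOrder ≥-decTotalOrder (key m)

module SortKey {n} (m : Monomial n) = SortingAlgorithm (InsertionSort.insertionSort (keyOrder m))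

pos : Monomial n → List (Fin n)
pos {n} m = SortKey.sort m (allFin n)

pos-↭ : ∀ (m : Monomial n) → pos m ↭ allFin n
pos-↭ {n} m = SortKey.sort-↭ m (allFin n)

module _ {ps : List (Fin n)} (p : ps ↭ allFin n) where

  enum-unique : Unique ps
  enum-unique = ↭ₛ.Unique-resp-↭ (setoid (Fin n)) (↭⇒↭ₛ (↭-sym p)) (Uniqueₚ.allFin⁺ n)

  enum-∈ : ∀ i → i ∈ ps
  enum-∈ i = ∈-resp-↭ (↭-sym p) (∈-allFin i)

  enum-length : length ps ≡ n
  enum-length = trans (↭-length p) (length-tabulate (λ i → i))

  enum-ext : ∀ {A : Set} {f g : Fin n → A} → map f ps ≡ map g ps → ∀ i → f i ≡ g i
  enum-ext eq i = agree ps eq (enum-∈ i)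
    where
    agree : ∀ {A : Set} {f g : Fin n → A} qs → map f qs ≡ map g qs → i ∈ qs → f i ≡ g i
    agree (q ∷ qs) eq (here refl) = proj₁ (∷-injective eq)
    agree (q ∷ qs) eq (there i∈)  = agree qs (proj₂ (∷-injective eq)) i∈

pos-before : ∀ (m : Monomial n) → AllPairs (Before m) (pos m)
pos-before {n} m = AllPairs.zipWith strict
  ( Linked⇒AllPairs (λ a b → ℕₚ.≤-trans b a) (SortKey.sort-↗ m (allFin n))
  , enum-unique (pos-↭ m))
  where
  strict : ∀ {i j} → key m i ≥ key m j × i ≢ j → Before m i j
  strict {i} {j} (ge , i≢j) with before-total m i j i≢j
  ... | inj₁ b = b
  ... | inj₂ b = contradiction ge (ℕₚ.<⇒≱ b)

pos-unique : ∀ (m : Monomial n) {ps} → ps ↭ allFin n → AllPairs (Before m) ps → pos m ≡ ps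
pos-unique m p b = sorted-unique (λ a b → contradiction a (ℕₚ.<-asym b))
  (pos-before m) b (↭-trans (pos-↭ m) (↭-sym p))

toList-lookup : ∀ (m : Monomial n) → map (lookup m) (allFin n) ≡ toList m
toList-lookup m = trans (map-tabulate (λ i → i) (lookup m)) (go m)
  where
  go : ∀ {n} (m : Monomial n) → List.tabulate (lookup m) ≡ toList m
  go []      = refl
  go (x ∷ m) = cong (x ∷_) (go m)

map-enum-↭ : ∀ (m : Monomial n) {ps} → ps ↭ allFin n → map (lookup m) ps ↭ toList m
map-enum-↭ m {ps} p = subst (map (lookup m) ps ↭_) (toList-lookup m) (↭-map⁺ (lookup m) p)

expPartition-enum : ∀ (m : Monomial n) {ps} → ps ↭ allFin n → Descending (map (lookup m) ps) →
  expPartition m ≡ map (lookup m) ps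
expPartition-enum m p d = expPartition-unique m d (map-enum-↭ m p)

length-expPartition : ∀ (m : Monomial n) → length (expPartition m) ≡ n
length-expPartition m = trans (↭-length (expPartition-↭ m)) (length-toList m)
  where
  length-toList : ∀ {n} (m : Monomial n) → length (toList m) ≡ n
  length-toList []      = refl
  length-toList (x ∷ m) = cong suc (length-toList m)

sum-expPartition : ∀ (m : Monomial n) → sumℕ (expPartition m) ≡ degree m
sum-expPartition m = trans (sum-↭ (expPartition-↭ m)) (sum-toList m)
  where
  sum-toList : ∀ {n} (m : Monomial n) → sumℕ (toList m) ≡ Vec.sum m
  sum-toList []      = refl
  sum-toList (x ∷ m) = cong (x +_) (sum-toList m)

-- Enumerations of the positions and the permutations between them

assoc : ∀ {A : Set} → (Fin n → A) → List (Fin n) → List A → Fin n → A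
assoc d (p ∷ ps) (b ∷ bs) i with i Fin.≟ p
... | yes _ = b
... | no  _ = assoc d ps bs i
assoc d _ _ i = d i

assoc-here : ∀ {A : Set} (d : Fin n → A) p ps b bs → assoc d (p ∷ ps) (b ∷ bs) p ≡ b
assoc-here d p ps b bs with p Fin.≟ p
... | yes _  = refl
... | no  ne = contradiction refl ne

assoc-there : ∀ {A : Set} (d : Fin n → A) {p} ps b bs {i} → i ≢ p →
  assoc d (p ∷ ps) (b ∷ bs) i ≡ assoc d ps bs i
assoc-there d {p} ps b bs {i} ne with i Fin.≟ p
... | yes eq = contradiction eq ne
... | no  _  = refl

map-assoc : ∀ {A : Set} (d : Fin n → A) {ps} → Unique ps → ∀ bs → length ps ≡ length bs →
  map (assoc d ps bs) ps ≡ bs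
map-assoc d []                  []       len = refl
map-assoc d (_∷_ {p} {ps} p∉ u) (b ∷ bs) len = cong₂ _∷_ (assoc-here d p ps b bs)
  (trans (map-cong-local (All.map (λ ne → assoc-there d ps b bs (ne ∘ sym)) p∉))
    (map-assoc d u bs (ℕₚ.suc-injective len)))

assoc-∈ : ∀ {A : Set} (d : Fin n → A) ps bs → length ps ≡ length bs → ∀ {i} → i ∈ ps → assoc d ps bs i ∈ bs
assoc-∈ d (p ∷ ps) (b ∷ bs) len {i} i∈ with i Fin.≟ p
... | yes _ = here refl
... | no ne with i∈
...   | here eq  = contradiction eq ne
...   | there i∈ = there (assoc-∈ d ps bs (ℕₚ.suc-injective len) i∈)

assoc-inverse : ∀ {ps qs : List (Fin n)} → Unique ps → Unique qs → length ps ≡ length qs →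
  ∀ {i} → i ∈ ps → assoc (λ j → j) qs ps (assoc (λ j → j) ps qs i) ≡ i
assoc-inverse [] _ _ ()
assoc-inverse {ps = p ∷ ps} {q ∷ qs} (p∉ ∷ ups) (q∉ ∷ uqs) len {i} i∈ with i Fin.≟ p
... | yes refl = assoc-here _ q qs p ps
... | no ne with i∈
...   | here eq  = contradiction eq ne
...   | there i∈ = trans
  (assoc-there _ qs p ps (All.lookup q∉ (assoc-∈ _ ps qs (ℕₚ.suc-injective len) i∈) ∘ sym))
  (assoc-inverse ups uqs (ℕₚ.suc-injective len) i∈)

-- Matches the two enumerations entry by entry. The condition is on `⟨$⟩ˡ` because `actM` reads
-- exponents through the inverse.
enumPerm : ∀ {ps qs : List (Fin n)} → ps ↭ allFin n → qs ↭ allFin n →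
  Σ (Permutation′ n) λ σ → map (σ ⟨$⟩ˡ_) ps ≡ qs
enumPerm {ps = ps} {qs} p q =
  permutation (assoc (λ j → j) qs ps) (assoc (λ j → j) ps qs)
    (λ i → assoc-inverse (enum-unique p) (enum-unique q) len (enum-∈ p i))
    (λ i → assoc-inverse (enum-unique q) (enum-unique p) (sym len) (enum-∈ q i))
  , map-assoc (λ j → j) (enum-unique p) qs len
  where
  len : length ps ≡ length qs
  len = trans (enum-length p) (sym (enum-length q))

-- Supplies the member of the orbit of `y` that is aligned with a prescribed ordering: the
-- permutation carries `pos y` to `ps`.
sortAlong : ∀ {ps : List (Fin n)} → ps ↭ allFin n → ∀ y →
  Σ (Permutation′ n) λ σ → Descending (map (lookup (actM σ y)) ps)
sortAlong {ps = ps} p y = σ , subst Descending (sym aligned)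
  (AllPairsₚ.map⁺ (AllPairs.map (λ {i} {j} b → ℕₚ.≤-trans (ℕₚ.m≤n+m _ (descent i j)) (before⇒descent y i j b)) (pos-before y)))
  where
  σ : Permutation′ _
  σ = proj₁ (enumPerm p (pos-↭ y))
  aligned : map (lookup (actM σ y)) ps ≡ map (lookup y) (pos y)
  aligned = trans (map-cong (lookup-actM σ y) ps)
    (trans (map-∘ ps) (cong (map (lookup y)) (proj₂ (enumPerm p (pos-↭ y)))))

desCount : List (Fin n) → ℕ
desCount []           = 0
desCount (i ∷ [])     = 0
desCount (i ∷ j ∷ ps) = descent i j + desCount (j ∷ ps)

-- The exponents of the Garsia-Stanton descent monomial along `ps`: each position receives the
-- number of descents from it to the end.
desList : List (Fin n) → List ℕ
desList []       = []
desList (i ∷ ps) = desCount (i ∷ ps) ∷ desList ps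

length-desList : ∀ (ps : List (Fin n)) → length (desList ps) ≡ length ps
length-desList []       = refl
length-desList (i ∷ ps) = cong suc (length-desList ps)

-- The default 0 is never read, since `pos m` lists every position.
base : Monomial n → Monomial n
base m = tabulate (assoc (λ _ → 0) (pos m) (desList (pos m)))

rest : Monomial n → Monomial n
rest m = zipWith _∸_ m (base m)

-- As `base` is idempotent (`base-basic`), these are exactly its values.
Basic : Monomial n → Set
Basic m = base m ≡ m

map-base : ∀ (m : Monomial n) → map (lookup (base m)) (pos m) ≡ desList (pos m)
map-base m = trans (map-cong (lookup∘tabulate _) (pos m))
  (map-assoc _ (enum-unique (pos-↭ m)) _ (sym (length-desList (pos m))))

desList-steps : ∀ (α : Fin n → ℕ) ps → map α ps ≡ desList ps → Linked (λ i j → α i ≡ descent i j + α j) ps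
desList-steps α []           eq = []
desList-steps α (i ∷ [])     eq = [-]
desList-steps α (i ∷ j ∷ ps) eq =
  trans (proj₁ (∷-injective eq)) (cong (descent i j +_) (sym (proj₁ (∷-injective (proj₂ (∷-injective eq))))))
  ∷ desList-steps α (j ∷ ps) (proj₂ (∷-injective eq))

-- Induction from the end, where the descent count is 0: at each step `α` rises by exactly the
-- descent and `m` by at least as much.
desList-≤ : ∀ (m : Monomial n) α ps → map α ps ≡ desList ps → Linked (Before m) ps →
  All (λ i → α i ≤ lookup m i) ps
desList-≤ m α []           eq bs = []
desList-≤ m α (i ∷ [])     eq bs = ℕₚ.≤-trans (ℕₚ.≤-reflexive (proj₁ (∷-injective eq))) z≤n ∷ []
desList-≤ m α (i ∷ j ∷ ps) eq (b ∷ bs)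
  with desList-≤ m α (j ∷ ps) (proj₂ (∷-injective eq)) bs | desList-steps α (i ∷ j ∷ ps) eq
... | le ∷ les | αi ∷ _ =
  (begin
    α i                        ≡⟨ αi ⟩
    descent i j + α j          ≤⟨ ℕₚ.+-monoʳ-≤ (descent i j) le ⟩
    descent i j + lookup m j   ≤⟨ before⇒descent m i j b ⟩
    lookup m i                 ∎) ∷ le ∷ les
  where open ℕₚ.≤-Reasoning

base-≤ : ∀ (m : Monomial n) i → lookup (base m) i ≤ lookup m i
base-≤ m i = All.lookup (desList-≤ m (lookup (base m)) (pos m) (map-base m) (AllPairs⇒Linked (pos-before m)))
  (enum-∈ (pos-↭ m) i)

base⊕rest : ∀ (m : Monomial n) → base m ⊕ rest m ≡ m
base⊕rest m = lookup-ext (λ i → trans (lookup-zipWith _+_ i (base m) (rest m))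
  (trans (cong (lookup (base m) i +_) (lookup-zipWith _∸_ i m (base m))) (ℕₚ.m+[n∸m]≡n (base-≤ m i))))

-- From one position of `pos m` to the next, `base m` drops by exactly the descent and `m` by at
-- least that, so the quotient drops weakly.
rest-descending : ∀ (m : Monomial n) → Descending (map (lookup (rest m)) (pos m))
rest-descending m = AllPairsₚ.map⁺ (Linked⇒AllPairs (λ a b → ℕₚ.≤-trans b a)
  (Linked.zipWith step (desList-steps (lookup (base m)) (pos m) (map-base m) , AllPairs⇒Linked (pos-before m))))
  where
  step : ∀ {i j} → lookup (base m) i ≡ descent i j + lookup (base m) j × Before m i j →
    lookup (rest m) i ≥ lookup (rest m) j
  step {i} {j} (eq , b) = begin
    lookup (rest m) j                                       ≡⟨ lookup-zipWith _∸_ j m (base m) ⟩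
    lookup m j ∸ lookup (base m) j                          ≡⟨ ℕₚ.[m+n]∸[m+o]≡n∸o (descent i j) _ _ ⟨
    (descent i j + lookup m j) ∸ (descent i j + lookup (base m) j)  ≡⟨ cong (descent i j + lookup m j ∸_) eq ⟨
    (descent i j + lookup m j) ∸ lookup (base m) i          ≤⟨ ℕₚ.∸-monoˡ-≤ (lookup (base m) i) (before⇒descent m i j b) ⟩
    lookup m i ∸ lookup (base m) i                          ≡⟨ lookup-zipWith _∸_ i m (base m) ⟨
    lookup (rest m) i                                       ∎
    where open ℕₚ.≤-Reasoning

-- A drop by exactly the descent just suffices to keep the order of two neighbouring positions, ties
-- included.
before-base : ∀ (m : Monomial n) → AllPairs (Before (base m)) (pos m)
before-base m = Linked⇒AllPairs (λ a b → ℕₚ.<-trans b a)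
  (Linked.zipWith (λ {i} {j} (eq , i≢j) → descent⇒before (base m) i j i≢j (ℕₚ.≤-reflexive (sym eq)))
    (desList-steps (lookup (base m)) (pos m) (map-base m) , AllPairs⇒Linked (enum-unique (pos-↭ m))))

pos-base : ∀ (m : Monomial n) → pos (base m) ≡ pos m
pos-base m = pos-unique (base m) (pos-↭ m) (before-base m)

base-pos : ∀ (m m′ : Monomial n) → pos m ≡ pos m′ → base m ≡ base m′
base-pos m m′ eq rewrite eq = refl

base-basic : ∀ (m : Monomial n) → Basic (base m)
base-basic m = base-pos (base m) m (pos-base m)

pos-⊕ : ∀ (a y : Monomial n) → Descending (map (lookup y) (pos a)) → pos (a ⊕ y) ≡ pos a
pos-⊕ a y d = pos-unique (a ⊕ y) (pos-↭ a)
  (AllPairs.zipWith step (AllPairs.zip (pos-before a , AllPairsₚ.map⁻ d) , enum-unique (pos-↭ a)))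
  where
  step : ∀ {i j} → (Before a i j × lookup y i ≥ lookup y j) × i ≢ j → Before (a ⊕ y) i j
  step {i} {j} ((b , ge) , i≢j) = descent⇒before (a ⊕ y) i j i≢j (begin
    descent i j + lookup (a ⊕ y) j                  ≡⟨ cong (descent i j +_) (lookup-zipWith _+_ j a y) ⟩
    descent i j + (lookup a j + lookup y j)         ≡⟨ ℕₚ.+-assoc (descent i j) _ _ ⟨
    (descent i j + lookup a j) + lookup y j         ≤⟨ ℕₚ.+-mono-≤ (before⇒descent a i j b) ge ⟩
    lookup a i + lookup y i                         ≡⟨ lookup-zipWith _+_ i a y ⟨
    lookup (a ⊕ y) i                                ∎)
    where open ℕₚ.≤-Reasoning

-- Uniqueness of the factorisation: with `base⊕rest` and `rest-descending`, monomials correspond to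
-- pairs of a basic `a` and an exponent vector descending along `pos a`.
base-⊕ : ∀ {a : Monomial n} → Basic a → ∀ y → Descending (map (lookup y) (pos a)) → base (a ⊕ y) ≡ a
base-⊕ {a = a} basic y d = trans (base-pos (a ⊕ y) a (pos-⊕ a y d)) basic

lookup-descending : ∀ (m : Monomial n) → Descending (map (lookup m) (pos m))
lookup-descending m = AllPairsₚ.map⁺ (AllPairs.map
  (λ {i} {j} b → ℕₚ.≤-trans (ℕₚ.m≤n+m _ (descent i j)) (before⇒descent m i j b)) (pos-before m))

expPartition-pos : ∀ (m : Monomial n) → expPartition m ≡ map (lookup m) (pos m)
expPartition-pos m = expPartition-enum m (pos-↭ m) (lookup-descending m)

-- Rearrangement and dominance

+-interchangeℕ : ∀ a b c d → (a + b) + (c + d) ≡ (a + c) + (b + d)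
+-interchangeℕ = solve-∀

prefix-map-+ : ∀ (f g : A → ℕ) xs j →
  prefix j (map (λ x → f x + g x) xs) ≡ prefix j (map f xs) + prefix j (map g xs)
prefix-map-+ f g xs       zero    = refl
prefix-map-+ f g []       (suc j) = refl
prefix-map-+ f g (x ∷ xs) (suc j) =
  trans (cong (f x + g x +_) (prefix-map-+ f g xs j)) (+-interchangeℕ (f x) (g x) _ _)

sum-map-+ : ∀ (f g : A → ℕ) xs →
  sumℕ (map (λ x → f x + g x) xs) ≡ sumℕ (map f xs) + sumℕ (map g xs)
sum-map-+ f g []       = refl
sum-map-+ f g (x ∷ xs) =
  trans (cong (f x + g x +_) (sum-map-+ f g xs)) (+-interchangeℕ (f x) (g x) _ _)

dot-map : ∀ (f g : A → ℕ) xs → sumℕ (map (λ x → f x * g x) xs) ≡ dot (map f xs) (map g xs)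
dot-map f g []       = refl
dot-map f g (x ∷ xs) = cong (f x * g x +_) (dot-map f g xs)

∑ : (Fin n → ℕ) → ℕ
∑ {n} f = sumℕ (map f (allFin n))

-- Chosen so that rank (a ⊕ y) depends on the arrangement of the entries of y
-- only through the scalar product of y with key a.
rank : Monomial n → ℕ
rank {n} m = ∑ λ i → n * (lookup m i * lookup m i) + 2 * (lookup m i * tie i)

rank-⊕ : ∀ (a y : Monomial n) {ps} → ps ↭ allFin n → rank (a ⊕ y) ≡
  rank a + sumℕ (map (λ v → n * (v * v)) (map (lookup y) (allFin n))) + 2 * dot (map (key a) ps) (map (lookup y) ps)
rank-⊕ {n} a y {ps} p = begin
  rank (a ⊕ y)
    ≡⟨ cong sumℕ (map-cong (λ i → trans
         (cong (λ v → n * (v * v) + 2 * (v * tie i)) (lookup-zipWith _+_ i a y))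
         (expand n (lookup a i) (lookup y i) (tie i))) (allFin n)) ⟩
  ∑ (λ i → (Q i + N i) + (K i + K i))
    ≡⟨ sum-map-+ (λ i → Q i + N i) (λ i → K i + K i) (allFin n) ⟩
  ∑ (λ i → Q i + N i) + ∑ (λ i → K i + K i)
    ≡⟨ cong₂ _+_ (sum-map-+ Q N (allFin n)) (sum-map-+ K K (allFin n)) ⟩
  (∑ Q + ∑ N) + (∑ K + ∑ K)
    ≡⟨ cong₂ (λ s t → (∑ Q + s) + t) (cong sumℕ (map-∘ (allFin n))) (cong (∑ K +_) (sym (ℕₚ.+-identityʳ (∑ K)))) ⟩
  (rank a + sumℕ (map (λ v → n * (v * v)) (map (lookup y) (allFin n)))) + 2 * ∑ K
    ≡⟨ cong (λ k → rank a + sumℕ (map (λ v → n * (v * v)) (map (lookup y) (allFin n))) + 2 * k)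
         (trans (sum-↭ (↭-map⁺ K (↭-sym p))) (dot-map (key a) (lookup y) ps)) ⟩
  rank a + sumℕ (map (λ v → n * (v * v)) (map (lookup y) (allFin n))) + 2 * dot (map (key a) ps) (map (lookup y) ps) ∎
  where
  open ≡-Reasoning
  Q N K : Fin n → ℕ
  Q i = n * (lookup a i * lookup a i) + 2 * (lookup a i * tie i)
  N i = n * (lookup y i * lookup y i)
  K i = key a i * lookup y i
  expand : ∀ n a y t → n * ((a + y) * (a + y)) + 2 * ((a + y) * t) ≡
    ((n * (a * a) + 2 * (a * t)) + n * (y * y)) + ((n * a + t) * y + (n * a + t) * y)
  expand = solve-∀

toList-actM : ∀ σ (m : Monomial n) → toList (actM σ m) ↭ toList m
toList-actM {n} σ m = subst (_↭ toList m)
  (trans (trans (sym (map-∘ (allFin n))) (map-cong (sym ∘ lookup-actM σ m) (allFin n)))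
    (toList-lookup (actM σ m)))
  (map-enum-↭ m (injective∧surjective⇒↭allFin (σ ⟨$⟩ˡ_) (σ ⟨$⟩ʳ_)
    (λ i → Perm.inverseʳ σ) (λ i → Perm.inverseˡ σ)))

expPartition-actM : ∀ σ (m : Monomial n) → expPartition (actM σ m) ≡ expPartition m
expPartition-actM σ m = sym (expPartition-unique m (expPartition-descending (actM σ m))
  (↭-trans (expPartition-↭ (actM σ m)) (toList-actM σ m)))

module Rearrangement (a y z : Monomial n)
  (y↓ : Descending (map (lookup y) (pos a))) (z~y : toList z ↭ toList y) where

  aligned-↭ : ∀ {qs} → qs ↭ allFin n → map (lookup z) qs ↭ map (lookup y) (pos a)
  aligned-↭ q = ↭-trans (map-enum-↭ z q) (↭-trans z~y (↭-sym (map-enum-↭ y (pos-↭ a))))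

  -- By `rank-⊕` only the scalar product with `key a` can differ. The keys decrease strictly along
  -- `pos a`, so equality in the rearrangement inequality forces `z ≡ y`.
  rank-< : z ≡ y ⊎ rank (a ⊕ z) < rank (a ⊕ y)
  rank-< with dot-dominance (map (key a) (pos a)) (map (lookup y) (pos a)) (map (lookup z) (pos a))
    (AllPairsₚ.map⁺ (pos-before a))
    (trans (length-map _ (pos a)) (sym (length-map _ (pos a))))
    (trans (length-map _ (pos a)) (sym (length-map _ (pos a))))
    (prefix-↭ y↓ (aligned-↭ (pos-↭ a))) (sum-↭ (aligned-↭ (pos-↭ a)))
  ... | inj₁ eq = inj₁ (lookup-ext (enum-ext (pos-↭ a) eq))
  ... | inj₂ lt = inj₂ (begin-strict
    rank (a ⊕ z)  ≡⟨ rank-⊕ a z (pos-↭ a) ⟩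
    rank a + squares z + 2 * dot (map (key a) (pos a)) (map (lookup z) (pos a))
      ≡⟨ cong (λ s → rank a + s + 2 * dot (map (key a) (pos a)) (map (lookup z) (pos a)))
           (sum-↭ (↭-map⁺ (λ v → n * (v * v)) (↭-trans (aligned-↭ ↭-refl) (↭-map⁺ (lookup y) (pos-↭ a))))) ⟩
    rank a + squares y + 2 * dot (map (key a) (pos a)) (map (lookup z) (pos a))
      <⟨ ℕₚ.+-monoʳ-< (rank a + squares y) (ℕₚ.*-monoʳ-< 2 lt) ⟩
    rank a + squares y + 2 * dot (map (key a) (pos a)) (map (lookup y) (pos a))
      ≡⟨ rank-⊕ a y (pos-↭ a) ⟨
    rank (a ⊕ y)  ∎)
    where
    open ℕₚ.≤-Reasoning
    squares : Monomial n → ℕ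
    squares x = sumℕ (map (λ v → n * (v * v)) (map (lookup x) (allFin n)))

  map-⊕ : ∀ (x : Monomial n) qs → map (lookup (a ⊕ x)) qs ≡ map (λ i → lookup a i + lookup x i) qs
  map-⊕ x = map-cong (λ i → lookup-zipWith _+_ i a x)

  -- Along any ordering, the prefix sums of `a` and of `z` are at most those of their descending
  -- rearrangements. The ordering `pos a` attains both maxima at once, because `y` is aligned with
  -- `a`.
  expPartition-⊴ : expPartition (a ⊕ z) ⊴ expPartition (a ⊕ y)
  expPartition-⊴ rewrite expPartition-pos (a ⊕ y) | pos-⊕ a y y↓ | map-⊕ y (pos a)
                       | expPartition-pos (a ⊕ z) | map-⊕ z (pos (a ⊕ z)) = total , dominated
    where
    qs : List (Fin n)
    qs = pos (a ⊕ z)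
    a↭ : map (lookup a) qs ↭ map (lookup a) (pos a)
    a↭ = ↭-map⁺ (lookup a) (↭-trans (pos-↭ (a ⊕ z)) (↭-sym (pos-↭ a)))
    total : sumℕ (map (λ i → lookup a i + lookup z i) qs) ≡ sumℕ (map (λ i → lookup a i + lookup y i) (pos a))
    total = trans (sum-map-+ (lookup a) (lookup z) qs)
      (trans (cong₂ _+_ (sum-↭ a↭) (sum-↭ (aligned-↭ (pos-↭ (a ⊕ z)))))
        (sym (sum-map-+ (lookup a) (lookup y) (pos a))))
    dominated : ∀ j → prefix j (map (λ i → lookup a i + lookup z i) qs) ≤ prefix j (map (λ i → lookup a i + lookup y i) (pos a))
    dominated j = begin
      prefix j (map (λ i → lookup a i + lookup z i) qs)
        ≡⟨ prefix-map-+ (lookup a) (lookup z) qs j ⟩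
      prefix j (map (lookup a) qs) + prefix j (map (lookup z) qs)
        ≤⟨ ℕₚ.+-mono-≤ (prefix-↭ (lookup-descending a) a↭ j) (prefix-↭ y↓ (aligned-↭ (pos-↭ (a ⊕ z))) j) ⟩
      prefix j (map (lookup a) (pos a)) + prefix j (map (lookup y) (pos a))
        ≡⟨ prefix-map-+ (lookup a) (lookup y) (pos a) j ⟨
      prefix j (map (λ i → lookup a i + lookup y i) (pos a)) ∎
      where open ℕₚ.≤-Reasoning

-- Descent sets and the partitions λ_S

descentSet : ∀ (ps : List (Fin n)) → Σ (Subset (length ps)) λ S →
  AvoidsLast S × lamS S ≡ desList ps × count S ≡ desCount ps
descentSet []       = [] , tt , refl , refl
-- No descent starts at the last position, hence n ∉ S. The equality of counts is carried along
-- because the counts are the heads of `lamS` and `desList`.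
descentSet (i ∷ []) = false ∷ [] , refl , refl , refl
descentSet (i ∷ j ∷ ps) with descentSet (j ∷ ps) | j Fin.<? i
... | c ∷ S , avoids , lam , cnt | yes _ = true ∷ c ∷ S , avoids , cong₂ _∷_ (cong suc cnt) lam , cong suc cnt
... | c ∷ S , avoids , lam , cnt | no  _ = false ∷ c ∷ S , avoids , cong₂ _∷_ cnt lam , cnt

basic⇒lamS : ∀ {a : Monomial n} → Basic a → Σ (Subset n) λ S → AvoidsLast S × lamS S ≡ expPartition a
basic⇒lamS {n} {a} basic = go (enum-length (pos-↭ a)) (descentSet (pos a))
  where
  lam≡ : desList (pos a) ≡ expPartition a
  lam≡ = trans (sym (map-base a)) (trans (cong (λ b → map (lookup b) (pos a)) basic) (sym (expPartition-pos a)))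
  go : length (pos a) ≡ n →
    (Σ (Subset (length (pos a))) λ S → AvoidsLast S × lamS S ≡ desList (pos a) × count S ≡ desCount (pos a)) →
    Σ (Subset n) λ S → AvoidsLast S × lamS S ≡ expPartition a
  go len (S , avoids , lam , _) = subst (λ k → Σ (Subset k) λ S → AvoidsLast S × lamS S ≡ expPartition a) len
    (S , avoids , trans lam lam≡)

-- Double counting: an element in position i is counted once in each of the first i entries of
-- `lamS S`, and the offset adds `off` for every element.
weightFrom-lamS : ∀ off (S : Subset n) → weightFrom off S ≡ off * count S + sumℕ (lamS S)
weightFrom-lamS off []          = sym (trans (ℕₚ.+-identityʳ (off * 0)) (ℕₚ.*-zeroʳ off))
weightFrom-lamS off (true ∷ S)  = trans (cong (suc off +_) (weightFrom-lamS (suc off) S)) (arith off (count S) (sumℕ (lamS S)))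
  where
  arith : ∀ o c s → suc o + (suc o * c + s) ≡ o * suc c + (suc c + s)
  arith = solve-∀
weightFrom-lamS off (false ∷ S) = trans (weightFrom-lamS (suc off) S) (arith off (count S) (sumℕ (lamS S)))
  where
  arith : ∀ o c s → suc o * c + s ≡ o * c + (c + s)
  arith = solve-∀

weight-lamS : ∀ (S : Subset n) → weight S ≡ sumℕ (lamS S)
weight-lamS S = weightFrom-lamS 0 S

lamS-injective : ∀ (S T : Subset n) → lamS S ≡ lamS T → S ≡ T
lamS-injective []      []      eq = refl
lamS-injective (b ∷ S) (c ∷ T) eq with refl ← lamS-injective S T (proj₂ (∷-injective eq)) =
  cong (_∷ S) (heads b c (proj₁ (∷-injective eq)))
  where
  heads : ∀ b c → count (b ∷ S) ≡ count (c ∷ S) → b ≡ c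
  heads true  true  _ = refl
  heads false false _ = refl
  heads true  false e = contradiction e ℕₚ.1+n≢n
  heads false true  e = contradiction (sym e) ℕₚ.1+n≢n

-- Straightening

-- The sum runs over the group, so this is the monomial symmetric polynomial of `y` times the order
-- of the stabiliser of `y`.
orbit : Monomial n → Poly n
orbit {n} y = map (λ σ → (1ℚ , actM σ y)) (perms n)

eval-unit : ∀ {A : Set} (h : Monomial n → ℚ) (g : A → Monomial n) xs →
  eval h (map (λ x → (1ℚ , g x)) xs) ≡ Σ⟨ xs ⟩ (h ∘ g)
eval-unit h g []       = refl
eval-unit h g (x ∷ xs) = cong₂ ℚ._+_ (ℚₚ.*-identityˡ (h (g x))) (eval-unit h g xs)

eval-orbit : ∀ (h : Monomial n → ℚ) y → eval h (orbit y) ≡ Σ⟨ perms n ⟩ (λ σ → h (actM σ y))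
eval-orbit {n} h y = eval-unit h (λ σ → actM σ y) (perms n)

actM-extensional : ∀ (h : Monomial n → ℚ) y → Extensional (λ σ → h (actM σ y))
actM-extensional h y σ ρ eq = cong h (actM-cong σ ρ eq y)

orbit-symmetric : ∀ (y : Monomial n) → Symmetric (orbit y)
orbit-symmetric {n} y τ = ≋⇒≈P {p = act τ (orbit y)} {orbit y} λ h → begin
  eval h (act τ (orbit y))                      ≡⟨ eval-act h τ (orbit y) ⟩
  eval (h ∘ actM τ) (orbit y)                   ≡⟨ eval-orbit (h ∘ actM τ) y ⟩
  Σ⟨ perms n ⟩ (λ σ → h (actM τ (actM σ y)))    ≡⟨ Σ-cong (λ σ → cong h (actM-∘ σ τ y)) (perms n) ⟨
  Σ⟨ perms n ⟩ (λ σ → h (actM (σ ∘ₚ τ) y))      ≡⟨ Σ-postcompose _ (actM-extensional h y) τ ⟩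
  Σ⟨ perms n ⟩ (λ σ → h (actM σ y))             ≡⟨ eval-orbit h y ⟨
  eval h (orbit y)                              ∎
  where open ≡-Reasoning

orbit-actM : ∀ τ (y : Monomial n) → orbit (actM τ y) ≋ orbit y
orbit-actM {n} τ y h = begin
  eval h (orbit (actM τ y))                     ≡⟨ eval-orbit h (actM τ y) ⟩
  Σ⟨ perms n ⟩ (λ σ → h (actM σ (actM τ y)))    ≡⟨ Σ-cong (λ σ → cong h (actM-∘ τ σ y)) (perms n) ⟨
  Σ⟨ perms n ⟩ (λ σ → h (actM (τ ∘ₚ σ) y))      ≡⟨ Σ-precompose _ (actM-extensional h y) τ ⟩
  Σ⟨ perms n ⟩ (λ σ → h (actM σ y))             ≡⟨ eval-orbit h y ⟨
  eval h (orbit y)                              ∎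
  where open ≡-Reasoning

actM-≢0 : ∀ τ {y : Monomial n} → y ≢ 0ᴹ → actM τ y ≢ 0ᴹ
actM-≢0 τ {y} y≢0 eq = y≢0 (trans (sym (actM-flipˡ τ y)) (trans (cong (actM (flip τ)) eq) (actM-0 (flip τ))))

orbit-noConstant : ∀ {y : Monomial n} → y ≢ 0ᴹ → NoConstantTerm (orbit y)
orbit-noConstant {n} {y} y≢0 = trans (coeff-eval (orbit y) 0ᴹ) (trans (eval-orbit (δ 0ᴹ) y)
  (trans (Σ-cong (λ σ → δ-≢ 0ᴹ (actM σ y) (actM-≢0 σ y≢0)) (perms n)) (Σ-0 (perms n))))

-- Summing `f` over all its translates, each equal to `f`, replaces every monomial by its orbit sum.
-- This expands a symmetric polynomial without choosing orbit representatives.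
symmetric-orbits : ∀ (f : Poly n) → Symmetric f → ∀ h →
  n!ℚ n ℚ.* eval h f ≡ eval (λ y → eval h (orbit y)) f
symmetric-orbits {n} f sf h = begin
  n!ℚ n ℚ.* eval h f                                   ≡⟨ Σ-const (eval h f) (perms n) ⟨
  Σ⟨ perms n ⟩ (λ σ → eval h f)                        ≡⟨ Σ-cong (λ σ → ≈P⇒≋ {p = act σ f} {f} (sf σ) h) (perms n) ⟨
  Σ⟨ perms n ⟩ (λ σ → eval h (act σ f))                ≡⟨ Σ-cong (λ σ → eval-act h σ f) (perms n) ⟩
  Σ⟨ perms n ⟩ (λ σ → eval (h ∘ actM σ) f)             ≡⟨ Σ-eval (λ σ → h ∘ actM σ) (perms n) f ⟩
  eval (λ y → Σ⟨ perms n ⟩ (λ σ → h (actM σ y))) f     ≡⟨ eval-cong (eval-orbit h) f ⟨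
  eval (λ y → eval h (orbit y)) f                      ∎
  where open ≡-Reasoning

⊕-∸ : ∀ (a y : Monomial n) → Vec.zipWith _∸_ (a ⊕ y) a ≡ y
⊕-∸ a y = lookup-ext (λ i → trans (lookup-zipWith _∸_ i (a ⊕ y) a)
  (trans (cong (_∸ lookup a i) (lookup-zipWith _+_ i a y)) (ℕₚ.m+n∸m≡n (lookup a i) (lookup y i))))

⊕-identityʳ : ∀ (a : Monomial n) → a ⊕ 0ᴹ ≡ a
⊕-identityʳ a = lookup-ext (λ i → trans (lookup-zipWith _+_ i a 0ᴹ)
  (trans (cong (lookup a i +_) (lookup-replicate i 0)) (ℕₚ.+-identityʳ _)))

⊕-≢0ʳ : ∀ (s : Monomial n) {t} → t ≢ 0ᴹ → s ⊕ t ≢ 0ᴹ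
⊕-≢0ʳ s {t} t≢0 eq = t≢0 (lookup-ext (λ i → trans
  (ℕₚ.m+n≡0⇒n≡0 (lookup s i) (trans (sym (lookup-zipWith _+_ i s t)) (trans (cong (λ v → lookup v i) eq) (lookup-replicate i 0))))
  (sym (lookup-replicate i 0))))

rest-≢0 : ∀ {m : Monomial n} → ¬ Basic m → rest m ≢ 0ᴹ
rest-≢0 {m = m} nb eq = nb (trans (sym (⊕-identityʳ (base m))) (trans (cong (base m ⊕_) (sym eq)) (base⊕rest m)))

-- Triangularity: m occurs in spread m, and all other terms have smaller rank.
spread : Monomial n → Poly n
spread {n} m = map (λ σ → (1ℚ , base m ⊕ actM σ (rest m))) (perms n)

eval-spread : ∀ (h : Monomial n → ℚ) m → eval h (spread m) ≡ eval (λ z → h (base m ⊕ z)) (orbit (rest m))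
eval-spread {n} h m = trans (eval-unit h (λ σ → base m ⊕ actM σ (rest m)) (perms n))
  (sym (eval-orbit (λ z → h (base m ⊕ z)) (rest m)))

module SpreadTerm (m : Monomial n) (σ : Permutation′ n) where
  open Rearrangement (base m) (rest m) (actM σ (rest m))
    (subst (λ ps → Descending (map (lookup (rest m)) ps)) (sym (pos-base m)) (rest-descending m))
    (toList-actM σ (rest m))

  ≡⊎rank< : base m ⊕ actM σ (rest m) ≡ m ⊎ rank (base m ⊕ actM σ (rest m)) < rank m
  ≡⊎rank< with rank-<
  ... | inj₁ eq = inj₁ (trans (cong (base m ⊕_) eq) (base⊕rest m))
  ... | inj₂ lt = inj₂ (subst (λ x → rank (base m ⊕ actM σ (rest m)) < rank x) (base⊕rest m) lt)

  dominated : expPartition (base m ⊕ actM σ (rest m)) ⊴ expPartition m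
  dominated = subst (λ x → expPartition (base m ⊕ actM σ (rest m)) ⊴ expPartition x) (base⊕rest m) expPartition-⊴

-- The number of permutations that fix `rest m`.
lead : Monomial n → ℚ
lead m = coeff (spread m) m

-- The identity contributes 1 and no permutation contributes a negative amount.
lead≢0 : ∀ (m : Monomial n) → lead m ≢ 0ℚ
lead≢0 {n} m eq = ℚₚ.<⇒≢ (Σ-perms-pos f ext nonneg f-id>0) (sym (trans
  (sym (eval-unit (δ m) (λ σ → base m ⊕ actM σ (rest m)) (perms n)))
  (trans (sym (coeff-eval (spread m) m)) eq)))
  where
  f : Permutation′ n → ℚ
  f σ = δ m (base m ⊕ actM σ (rest m))
  ext : Extensional f
  ext = actM-extensional (λ z → δ m (base m ⊕ z)) (rest m)
  nonneg : ∀ σ → 0ℚ ℚ.≤ f σ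
  nonneg σ with (base m ⊕ actM σ (rest m)) ≟M m
  ... | yes _ = ℚₚ.<⇒≤ 0<1
  ... | no  _ = ℚₚ.≤-refl
  f-id>0 : 0ℚ ℚ.< f Perm.id
  f-id>0 = subst (0ℚ ℚ.<_) (sym (trans
    (cong (δ m) (trans (cong (base m ⊕_) (actM-id (rest m))) (base⊕rest m))) (δ-refl m))) 0<1

lower : Monomial n → Poly n
lower m = without m (spread m)

Allᴹ : (Monomial n → Set) → Poly n → Set
Allᴹ P = All (P ∘ proj₂)

lower-terms : ∀ (m : Monomial n) → Allᴹ (λ t → rank t < rank m × expPartition t ⊴ expPartition m) (lower m)
lower-terms {n} m = All.zipWith (λ {t} → pick {t})
  ( Allₚ.all-filter (λ t → ¬? (proj₂ t ≟M m)) (spread m)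
  , Allₚ.filter⁺ (λ t → ¬? (proj₂ t ≟M m)) (Allₚ.map⁺ (All.universal (λ σ → SpreadTerm.≡⊎rank< m σ , SpreadTerm.dominated m σ) (perms n))))
  where
  pick : ∀ {t : ℚ × Monomial n} → ¬ (proj₂ t ≡ m) × ((proj₂ t ≡ m ⊎ rank (proj₂ t) < rank m) × expPartition (proj₂ t) ⊴ expPartition m) →
    rank (proj₂ t) < rank m × expPartition (proj₂ t) ⊴ expPartition m
  pick (ne , inj₁ eq , _) = contradiction eq ne
  pick (ne , inj₂ lt , d) = lt , d

measure-rec : (μ : Monomial n → ℕ) (P : Monomial n → Set) →
  (∀ m → (∀ t → μ t < μ m → P t) → P m) → ∀ m → P m
measure-rec μ P step m = <-rec (λ r → ∀ m → μ m ≡ r → P m)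
  (λ { r rec m refl → step m (λ t lt → rec lt t refl) }) (μ m) m refl

lin-cong-All : ∀ {f g : Monomial n → Poly n} {p} → Allᴹ (λ t → f t ≡ g t) p → lin f p ≡ lin g p
lin-cong-All []                     = refl
lin-cong-All (_∷_ {c , m} eq eqs) = cong₂ _++_ (cong (c ·P_) eq) (lin-cong-All eqs)

eval-All0 : ∀ {h : Monomial n → ℚ} {p} → Allᴹ (λ t → h t ≡ 0ℚ) p → eval h p ≡ 0ℚ
eval-All0 []                   = refl
eval-All0 (_∷_ {c , m} eq eqs) = trans (cong₂ ℚ._+_ (trans (cong (c ℚ.*_) eq) (ℚₚ.*-zeroʳ c)) (eval-All0 eqs))
  (ℚₚ.+-identityˡ 0ℚ)

All-· : ∀ {P : Monomial n → Set} c {p} → Allᴹ P p → Allᴹ P (c ·P p)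
All-· c a = Allₚ.map⁺ a

All-lin : ∀ {P : Monomial n → Set} {f p} → Allᴹ (λ t → Allᴹ P (f t)) p → Allᴹ P (lin f p)
All-lin []                 = []
All-lin (_∷_ {c , m} a as) = Allₚ.++⁺ (All-· c a) (All-lin as)

-- Solves the relation `spread m` ≡ 0 for its leading monomial `m` and repeats on the rest. The
-- first argument is fuel: ranks drop, so the empty result for fuel 0 is never reached from `red`.
redF : ℕ → Monomial n → Poly n
redF zero    m = []
redF (suc k) m with base m ≟M m
... | yes _ = mono m
... | no  _ = (ℚ.- inv (lead m) (lead≢0 m)) ·P lin (redF k) (lower m)

redF-fuel : ∀ k l (m : Monomial n) → rank m < k → rank m < l → redF k m ≡ redF l m
redF-fuel (suc k) (suc l) m (s≤s m<k) (s≤s m<l) with base m ≟M m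
... | yes _ = refl
... | no  _ = cong ((ℚ.- inv (lead m) (lead≢0 m)) ·P_) (lin-cong-All
  (All.map (λ {t} (lt , _) → redF-fuel k l (proj₂ t) (ℕₚ.<-≤-trans lt m<k) (ℕₚ.<-≤-trans lt m<l)) (lower-terms m)))

red : Monomial n → Poly n
red m = redF (suc (rank m)) m

red-basic : ∀ {m : Monomial n} → Basic m → red m ≡ mono m
red-basic {m = m} b with base m ≟M m
... | yes _ = refl
... | no nb = contradiction b nb

red-step : ∀ {m : Monomial n} → ¬ Basic m → red m ≡ (ℚ.- inv (lead m) (lead≢0 m)) ·P lin red (lower m)
red-step {m = m} nb with base m ≟M m
... | yes b = contradiction b nb
... | no  _ = cong ((ℚ.- inv (lead m) (lead≢0 m)) ·P_) (lin-cong-All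
  (All.map (λ {t} (lt , _) → redF-fuel (rank m) (suc (rank (proj₂ t))) (proj₂ t) lt (ℕₚ.n<1+n _)) (lower-terms m)))

eval-red-step : ∀ {m : Monomial n} → ¬ Basic m → ∀ h →
  eval h (red m) ≡ (ℚ.- inv (lead m) (lead≢0 m)) ℚ.* eval (λ t → eval h (red t)) (lower m)
eval-red-step {m = m} nb h = trans (cong (eval h) (red-step nb))
  (trans (eval-· h (ℚ.- inv (lead m) (lead≢0 m)) (lin red (lower m)))
    (cong ((ℚ.- inv (lead m) (lead≢0 m)) ℚ.*_) (eval-lin h red (lower m))))

lead-inv : ∀ (m : Monomial n) → inv (lead m) (lead≢0 m) ℚ.* lead m ≡ 1ℚ
lead-inv m = ℚₚ.*-inverseˡ (lead m) {{ℚ.≢-nonZero (lead≢0 m)}}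

red-spread : ∀ {m : Monomial n} → ¬ Basic m → ∀ h → eval (λ t → eval h (red t)) (spread m) ≡ 0ℚ
red-spread {m = m} nb h = begin
  eval g (spread m)                                     ≡⟨ eval-without g m (spread m) ⟩
  lead m ℚ.* g m ℚ.+ eval g (lower m)                   ≡⟨ cong (λ x → lead m ℚ.* x ℚ.+ eval g (lower m)) (eval-red-step nb h) ⟩
  lead m ℚ.* ((ℚ.- v) ℚ.* eval g (lower m)) ℚ.+ eval g (lower m)  ≡⟨ arith (lead m) v (eval g (lower m)) ⟩
  (ℚ.- (v ℚ.* lead m)) ℚ.* eval g (lower m) ℚ.+ eval g (lower m)  ≡⟨ cong (λ x → (ℚ.- x) ℚ.* eval g (lower m) ℚ.+ eval g (lower m)) (lead-inv m) ⟩
  (ℚ.- 1ℚ) ℚ.* eval g (lower m) ℚ.+ eval g (lower m)    ≡⟨ cong (ℚ._+ eval g (lower m)) (-1*x (eval g (lower m))) ⟩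
  (ℚ.- eval g (lower m)) ℚ.+ eval g (lower m)           ≡⟨ ℚₚ.+-inverseˡ (eval g (lower m)) ⟩
  0ℚ                                                    ∎
  where
  open ≡-Reasoning
  g : Monomial _ → ℚ
  g t = eval h (red t)
  v : ℚ
  v = inv (lead m) (lead≢0 m)
  arith : ∀ l v e → l ℚ.* ((ℚ.- v) ℚ.* e) ℚ.+ e ≡ (ℚ.- (v ℚ.* l)) ℚ.* e ℚ.+ e
  arith = solve 3 (λ l v e → l :* ((:- v) :* e) :+ e := (:- (v :* l)) :* e :+ e) refl
    where open +-*-Solver

basic? : (m : Monomial n) → Basic m ⊎ ¬ Basic m
basic? m with base m ≟M m
... | yes b = inj₁ b
... | no nb = inj₂ nb

red-terms : ∀ (m : Monomial n) → Allᴹ (λ t → Basic t × expPartition t ⊴ expPartition m) (red m)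
red-terms = measure-rec rank _ step
  where
  step : ∀ m → (∀ t → rank t < rank m → Allᴹ (λ x → Basic x × expPartition x ⊴ expPartition t) (red t)) →
    Allᴹ (λ t → Basic t × expPartition t ⊴ expPartition m) (red m)
  step m rec with basic? m
  ... | inj₁ b  = subst (Allᴹ _) (sym (red-basic b)) ((b , ⊴-refl {expPartition m}) ∷ [])
  ... | inj₂ nb = subst (Allᴹ _) (sym (red-step nb)) (All-· (ℚ.- inv (lead m) (lead≢0 m)) (All-lin
    (All.map (λ {t} (lt , d) → All.map (λ {x} (b , d′) → b , ⊴-trans {expPartition (proj₂ x)} {expPartition (proj₂ t)} {expPartition m} d′ d) (rec (proj₂ t) lt)) (lower-terms m))))

-- Membership in the ideal

InI-resp-≋ : ∀ (p q : Poly n) → p ≋ q → InI q → InI p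
InI-resp-≋ p q eq (gfs , good , q≈) = gfs , good , λ m → trans (≋⇒≈P {p = p} {q} eq m) (q≈ m)

InI-0 : InI {n} 0P
InI-0 = [] , [] , λ m → refl

products : List (Poly n × Poly n) → Poly n
products gfs = sumP (map (λ gf → proj₁ gf *P proj₂ gf) gfs)

eval-products-++ : ∀ (h : Monomial n → ℚ) xs ys →
  eval h (products (xs ++ ys)) ≡ eval h (products xs) ℚ.+ eval h (products ys)
eval-products-++ h []             ys = sym (ℚₚ.+-identityˡ _)
eval-products-++ h ((g , f) ∷ xs) ys = trans (eval-++ h (g *P f) (products (xs ++ ys)))
  (trans (cong (eval h (g *P f) ℚ.+_) (eval-products-++ h xs ys))
    (trans (sym (ℚₚ.+-assoc (eval h (g *P f)) (eval h (products xs)) (eval h (products ys)))) (cong (ℚ._+ eval h (products ys)) (sym (eval-++ h (g *P f) (products xs))))))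

InI-+ : ∀ (p q : Poly n) → InI p → InI q → InI (p +P q)
InI-+ p q (xs , gx , ex) (ys , gy , ey) = xs ++ ys , Allₚ.++⁺ gx gy ,
  ≋⇒≈P {p = p +P q} {products (xs ++ ys)} λ h → trans (eval-++ h p q)
    (trans (cong₂ ℚ._+_ (≈P⇒≋ {p = p} {products xs} ex h) (≈P⇒≋ {p = q} {products ys} ey h))
      (sym (eval-products-++ h xs ys)))

-- Closure of the ideal under an operation on polynomials that can be moved
-- onto the first factor of each product.
InI-map : ∀ (p : Poly n) (φ : Poly n → Poly n) (k : (Monomial n → ℚ) → Monomial n → ℚ) →
  (∀ h p → eval h (φ p) ≡ eval (k h) p) →
  (∀ g f → Symmetric f → ∀ h → eval h (φ g *P f) ≡ eval (k h) (g *P f)) →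
  InI p → InI (φ p)
InI-map p φ k eval-φ mul (xs , good , ex) = map (λ gf → φ (proj₁ gf) , proj₂ gf) xs , Allₚ.map⁺ good ,
  ≋⇒≈P {p = φ p} {products (map (λ gf → φ (proj₁ gf) , proj₂ gf) xs)} λ h →
    trans (eval-φ h p) (trans (≈P⇒≋ {p = p} {products xs} ex (k h)) (sym (moved h good)))
  where
  moved : ∀ h {xs} → All (λ gf → Symmetric (proj₂ gf) × NoConstantTerm (proj₂ gf)) xs →
    eval h (products (map (λ gf → φ (proj₁ gf) , proj₂ gf) xs)) ≡ eval (k h) (products xs)
  moved h [] = refl
  moved h {(g , f) ∷ xs} ((sf , _) ∷ good) =
    trans (eval-++ h (φ g *P f) _) (trans (cong₂ ℚ._+_ (mul g f sf h) (moved h good))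
      (sym (eval-++ (k h) (g *P f) (products xs))))

InI-· : ∀ c (p : Poly n) → InI p → InI (c ·P p)
InI-· c p = InI-map p (c ·P_) (λ h m → c ℚ.* h m)
  (λ h p → trans (eval-· h c p) (sym (eval-*h c h p)))
  (λ g f _ h → trans (eval-*P h (c ·P g) f) (trans (eval-· (λ s → eval (λ t → h (s ⊕ t)) f) c g)
    (trans (cong (c ℚ.*_) (sym (eval-*P h g f))) (sym (eval-*h c h (g *P f))))))

InI-act : ∀ τ (p : Poly n) → InI p → InI (act τ p)
InI-act τ p = InI-map p (act τ) (λ h → h ∘ actM τ) (λ h p → eval-act h τ p) λ g f sf h → begin
  eval h (act τ g *P f)
    ≡⟨ eval-*P h (act τ g) f ⟩
  eval (λ s → eval (λ t → h (s ⊕ t)) f) (act τ g)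
    ≡⟨ eval-act _ τ g ⟩
  eval (λ s → eval (λ t → h (actM τ s ⊕ t)) f) g
    -- Symmetry of `f` allows `τ` to be inserted into the second factor, after which it acts on the
    -- whole product.
    ≡⟨ eval-cong (λ s → ≈P⇒≋ {p = act τ f} {f} (sf τ) (λ t → h (actM τ s ⊕ t))) g ⟨
  eval (λ s → eval (λ t → h (actM τ s ⊕ t)) (act τ f)) g
    ≡⟨ eval-cong (λ s → trans (eval-act _ τ f) (eval-cong (λ t → cong h (sym (actM-⊕ τ s t))) f)) g ⟩
  eval (λ s → eval (λ t → h (actM τ (s ⊕ t))) f) g
    ≡⟨ eval-*P (h ∘ actM τ) g f ⟨
  eval (h ∘ actM τ) (g *P f) ∎
  where open ≡-Reasoning

InI-lin : ∀ (f : Monomial n → Poly n) {p} → Allᴹ (InI ∘ f) p → InI (lin f p)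
InI-lin f []                          = InI-0
InI-lin f (_∷_ {x = c , m} {xs = p} a as) = InI-+ (c ·P f m) (lin f p) (InI-· c (f m) a) (InI-lin f as)

-- As a polynomial, `spread m` is `base m` times the orbit sum of `rest m`, which has no constant
-- term once `rest m` is not 1.
InI-spread : ∀ {m : Monomial n} → ¬ Basic m → InI (spread m)
InI-spread {m = m} nb = (mono (base m) , orbit (rest m)) ∷ [] ,
  (orbit-symmetric (rest m) , orbit-noConstant (rest-≢0 nb)) ∷ [] ,
  ≋⇒≈P {p = spread m} {products ((mono (base m) , orbit (rest m)) ∷ [])} λ h →
    trans (eval-spread h m) (sym (trans (eval-++ h (mono (base m) *P orbit (rest m)) [])
      (trans (ℚₚ.+-identityʳ (eval h (mono (base m) *P orbit (rest m)))) (trans (eval-*P h (mono (base m)) (orbit (rest m)))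
        (eval-mono (λ s → eval (λ t → h (s ⊕ t)) (orbit (rest m))) (base m))))))

-- By the recursion, m - red m is `spread m` divided by `lead m`, minus a combination of the
-- differences t - red t for the terms t of `lower m`.
red-InI : ∀ (m : Monomial n) → InI (mono m -P red m)
red-InI = measure-rec rank _ step
  where
  step : ∀ m → (∀ t → rank t < rank m → InI (mono t -P red t)) → InI (mono m -P red m)
  step m rec with basic? m
  ... | inj₁ b = InI-resp-≋ (mono m -P red m) [] (λ h → trans (eval-- h (mono m) (red m))
    (x≡y⇒x-y≡0 (cong (eval h) (sym (red-basic b))))) InI-0
  ... | inj₂ nb = InI-resp-≋ (mono m -P red m) (v ·P spread m +P (ℚ.- v) ·P D) expand (InI-+ (v ·P spread m) ((ℚ.- v) ·P D) (InI-· v (spread m) (InI-spread nb))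
    (InI-· (ℚ.- v) (lin (λ t → mono t -P red t) (lower m)) (InI-lin (λ t → mono t -P red t) (All.map (λ {t} (lt , _) → rec (proj₂ t) lt) (lower-terms m)))))
    where
    v : ℚ
    v = inv (lead m) (lead≢0 m)
    D : Poly _
    D = lin (λ t → mono t -P red t) (lower m)
    expand : mono m -P red m ≋ (v ·P spread m) +P ((ℚ.- v) ·P D)
    expand h = begin
      eval h (mono m -P red m)
        ≡⟨ trans (eval-- h (mono m) (red m)) (cong₂ ℚ._-_ (eval-mono h m) (eval-red-step nb h)) ⟩
      h m ℚ.- (ℚ.- v) ℚ.* E
        ≡⟨ cong (ℚ._- (ℚ.- v) ℚ.* E) (inv-* (lead m) (lead≢0 m) (h m)) ⟨
      v ℚ.* (lead m ℚ.* h m) ℚ.- (ℚ.- v) ℚ.* E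
        ≡⟨ arith v (lead m ℚ.* h m) W E ⟩
      v ℚ.* (lead m ℚ.* h m ℚ.+ W) ℚ.+ (ℚ.- v) ℚ.* (W ℚ.+ (ℚ.- 1ℚ) ℚ.* E)
        ≡⟨ cong₂ (λ x y → v ℚ.* x ℚ.+ (ℚ.- v) ℚ.* y) (sym (eval-without h m (spread m))) tail-eq ⟩
      v ℚ.* eval h (spread m) ℚ.+ (ℚ.- v) ℚ.* eval h D
        ≡⟨ cong₂ ℚ._+_ (eval-· h v (spread m)) (eval-· h (ℚ.- v) D) ⟨
      eval h (v ·P spread m) ℚ.+ eval h ((ℚ.- v) ·P D)
        ≡⟨ eval-++ h (v ·P spread m) ((ℚ.- v) ·P D) ⟨
      eval h ((v ·P spread m) +P ((ℚ.- v) ·P D)) ∎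
      where
      open ≡-Reasoning
      W E : ℚ
      W = eval h (lower m)
      E = eval (λ t → eval h (red t)) (lower m)
      arith : ∀ v x w e → v ℚ.* x ℚ.- (ℚ.- v) ℚ.* e ≡ v ℚ.* (x ℚ.+ w) ℚ.+ (ℚ.- v) ℚ.* (w ℚ.+ (ℚ.- 1ℚ) ℚ.* e)
      arith = solve 4 (λ v x w e → v :* x :- (:- v) :* e := v :* (x :+ w) :+ (:- v) :* (w :+ con (ℚ.- 1ℚ) :* e)) refl
        where open +-*-Solver
      tail-eq : W ℚ.+ (ℚ.- 1ℚ) ℚ.* E ≡ eval h D
      tail-eq = sym (trans (eval-lin h (λ t → mono t -P red t) (lower m)) (trans
        (eval-cong (λ t → trans (eval-++ h (mono t) (-P red t)) (cong₂ ℚ._+_ (eval-mono h t) (eval-· h (ℚ.- 1ℚ) (red t)))) (lower m))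
        (trans (eval-+h h (λ t → (ℚ.- 1ℚ) ℚ.* eval h (red t)) (lower m)) (cong (W ℚ.+_) (eval-*h (ℚ.- 1ℚ) (λ t → eval h (red t)) (lower m))))))

*P-symmetric : ∀ (f g : Poly n) → Symmetric f → Symmetric g → Symmetric (f *P g)
*P-symmetric f g sf sg τ = ≋⇒≈P {p = act τ (f *P g)} {f *P g} λ h → begin
  eval h (act τ (f *P g))                                      ≡⟨ eval-act h τ (f *P g) ⟩
  eval (h ∘ actM τ) (f *P g)                                   ≡⟨ eval-*P (h ∘ actM τ) f g ⟩
  eval (λ s → eval (λ t → h (actM τ (s ⊕ t))) g) f             ≡⟨ eval-cong (λ s → eval-cong (λ t → cong h (actM-⊕ τ s t)) g) f ⟩
  eval (λ s → eval (λ t → h (actM τ s ⊕ actM τ t)) g) f        ≡⟨ eval-cong (λ s → trans (sym (eval-act (λ t → h (actM τ s ⊕ t)) τ g)) (≈P⇒≋ {p = act τ g} {g} (sg τ) _)) f ⟩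
  eval (λ s → eval (λ t → h (actM τ s ⊕ t)) g) f               ≡⟨ trans (sym (eval-act _ τ f)) (≈P⇒≋ {p = act τ f} {f} (sf τ) _) ⟩
  eval (λ s → eval (λ t → h (s ⊕ t)) g) f                      ≡⟨ eval-*P h f g ⟨
  eval h (f *P g)                                              ∎
  where open ≡-Reasoning

*P-noConstant : ∀ (f g : Poly n) → NoConstantTerm g → NoConstantTerm (f *P g)
*P-noConstant f g nc = trans (coeff-eval (f *P g) 0ᴹ) (trans (eval-*P (δ 0ᴹ) f g)
  (trans (eval-cong (λ s → eval-supp0 g (λ t ne → δ-≢ 0ᴹ (s ⊕ t) (⊕-≢0ʳ s (λ eq → ne (trans (cong (coeff g) eq) nc))))) f) (eval-0h f)))

-- The reduction annihilates the ideal

module _ (h : Monomial n → ℚ) where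

  private
    H : Monomial n → ℚ
    H t = eval h (red t)

  -- Averaging reduces `f` to orbit sums. Each orbit has a member `y₀` aligned with `a`, and then
  -- `a` times the orbit sum is the spread of `a ⊕ y₀`, which `red-spread` kills.
  red-basic-symmetric : ∀ {a} f → Basic a → Symmetric f → NoConstantTerm f → eval (λ t → H (a ⊕ t)) f ≡ 0ℚ
  red-basic-symmetric {a} f ba sf nc = *-cancelˡ (n!ℚ≢0 n)
    (trans (symmetric-orbits f sf (λ t → H (a ⊕ t)))
      (trans (eval-supp0 f vanish) (sym (ℚₚ.*-zeroʳ (n!ℚ n)))))
    where
    vanish : ∀ y → coeff f y ≢ 0ℚ → eval (λ t → H (a ⊕ t)) (orbit y) ≡ 0ℚ
    vanish y ne = begin
      eval (λ t → H (a ⊕ t)) (orbit y)                  ≡⟨ orbit-actM σ y _ ⟨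
      eval (λ t → H (a ⊕ t)) (orbit y₀)                 ≡⟨ cong₂ (λ b r → eval (λ t → H (b ⊕ t)) (orbit r)) base-m rest-m ⟨
      eval (λ t → H (base m ⊕ t)) (orbit (rest m))      ≡⟨ eval-spread H m ⟨
      eval H (spread m)                                 ≡⟨ red-spread nb h ⟩
      0ℚ                                                ∎
      where
      open ≡-Reasoning
      σ : Permutation′ n
      σ = proj₁ (sortAlong (pos-↭ a) y)
      y₀ m : Monomial n
      y₀ = actM σ y
      m = a ⊕ y₀
      base-m : base m ≡ a
      base-m = base-⊕ ba y₀ (proj₂ (sortAlong (pos-↭ a) y))
      rest-m : rest m ≡ y₀
      rest-m = trans (cong (Vec.zipWith _∸_ m) base-m) (⊕-∸ a y₀)
      y≢0 : y ≢ 0ᴹ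
      y≢0 eq = ne (trans (cong (coeff f) eq) nc)
      nb : ¬ Basic m
      nb b = actM-≢0 σ y≢0 (trans (sym rest-m) (lookup-ext (λ i → trans (lookup-zipWith _∸_ i m (base m))
        (trans (cong (λ x → lookup m i ∸ lookup x i) b) (trans (ℕₚ.n∸n≡0 (lookup m i)) (sym (lookup-replicate i 0)))))))

  -- For `m` not basic, induction removes the lower terms of `spread m`, so `m` may be traded for
  -- `spread m`. Its orbit factor is then absorbed into `f`, which stays symmetric without constant
  -- term, and a basic multiplier is left.
  red-symmetric : ∀ f → Symmetric f → NoConstantTerm f → ∀ m → eval (λ t → H (m ⊕ t)) f ≡ 0ℚ
  red-symmetric f sf nc = measure-rec rank (λ m → φ m ≡ 0ℚ) step
    where
    φ : Monomial n → ℚ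
    φ m = eval (λ t → H (m ⊕ t)) f
    step : ∀ m → (∀ t → rank t < rank m → φ t ≡ 0ℚ) → φ m ≡ 0ℚ
    step m rec with basic? m
    ... | inj₁ b = red-basic-symmetric f b sf nc
    ... | inj₂ nb = *-cancelˡ (lead≢0 m) (begin
      lead m ℚ.* φ m                             ≡⟨ ℚₚ.+-identityʳ (lead m ℚ.* φ m) ⟨
      lead m ℚ.* φ m ℚ.+ 0ℚ                      ≡⟨ cong (lead m ℚ.* φ m ℚ.+_) (eval-All0 {p = lower m} (All.map (λ {t} (lt , _) → rec (proj₂ t) lt) (lower-terms m))) ⟨
      lead m ℚ.* φ m ℚ.+ eval φ (lower m)        ≡⟨ eval-without φ m (spread m) ⟨
      eval φ (spread m)                          ≡⟨ eval-spread φ m ⟩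
      eval (λ z → eval (λ t → H ((base m ⊕ z) ⊕ t)) f) (orbit (rest m))
        ≡⟨ eval-cong (λ z → eval-cong (λ t → cong H (zipWith-assoc ℕₚ.+-assoc (base m) z t)) f) (orbit (rest m)) ⟩
      eval (λ z → eval (λ t → H (base m ⊕ (z ⊕ t))) f) (orbit (rest m))
        ≡⟨ eval-*P (λ t → H (base m ⊕ t)) (orbit (rest m)) f ⟨
      eval (λ t → H (base m ⊕ t)) (orbit (rest m) *P f)
        ≡⟨ red-basic-symmetric (orbit (rest m) *P f) (base-basic m) (*P-symmetric (orbit (rest m)) f (orbit-symmetric (rest m)) sf) (*P-noConstant (orbit (rest m)) f nc) ⟩
      0ℚ                                         ≡⟨ ℚₚ.*-zeroʳ (lead m) ⟨
      lead m ℚ.* 0ℚ                              ∎)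
      where open ≡-Reasoning

  red-ideal : ∀ p → InI p → eval H p ≡ 0ℚ
  red-ideal p (xs , good , p≈) = trans (≈P⇒≋ {p = p} {products xs} p≈ H) (zero-products good)
    where
    zero-products : ∀ {xs} → All (λ gf → Symmetric (proj₂ gf) × NoConstantTerm (proj₂ gf)) xs → eval H (products xs) ≡ 0ℚ
    zero-products [] = refl
    zero-products {(g , f) ∷ xs} ((sf , nc) ∷ good) = trans (eval-++ H (g *P f) (products xs))
      (trans (cong₂ ℚ._+_ (trans (eval-*P H g f) (trans (eval-cong (red-symmetric f sf nc) g) (eval-0h g))) (zero-products good))
        (ℚₚ.+-identityˡ 0ℚ))

-- The isomorphism

_≟L_ : (μ ν : List ℕ) → Dec (μ ≡ ν)
_≟L_ = List-≡-dec ℕ._≟_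

coeff≢0⇒∈ : ∀ (p : Poly n) m → coeff p m ≢ 0ℚ → Any (λ t → proj₂ t ≡ m) p
coeff≢0⇒∈ []             m ne = contradiction refl ne
coeff≢0⇒∈ ((c , m′) ∷ p) m ne with m′ ≟M m
... | yes eq = here eq
... | no  _  = there (coeff≢0⇒∈ p m ne)

coeff≢0⇒All : ∀ {P : Monomial n → Set} {p m} → Allᴹ P p → coeff p m ≢ 0ℚ → P m
coeff≢0⇒All {P = P} {p} {m} all ne = pick all (coeff≢0⇒∈ p m ne)
  where
  pick : ∀ {q} → Allᴹ P q → Any (λ t → proj₂ t ≡ m) q → P m
  pick (px ∷ _)  (here refl) = px
  pick (_  ∷ ps) (there x∈)  = pick ps x∈

eval≢0⇒∃ : ∀ (h : Monomial n → ℚ) p → eval h p ≢ 0ℚ → ∃ λ m → coeff p m ≢ 0ℚ × h m ≢ 0ℚ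
eval≢0⇒∃ h p ne with Any.any? (λ t → ¬? (coeff p (proj₂ t) ℚₚ.≟ 0ℚ) ×-dec ¬? (h (proj₂ t) ℚₚ.≟ 0ℚ)) p
... | yes any = proj₂ (proj₁ (Any.satisfied any)) , proj₂ (Any.satisfied any)
... | no none = contradiction (eval-supp0 p vanish) ne
  where
  vanish : ∀ m → coeff p m ≢ 0ℚ → h m ≡ 0ℚ
  vanish m cm with h m ℚₚ.≟ 0ℚ
  ... | yes eq = eq
  ... | no  hm = contradiction (Any.map (λ { refl → cm , hm }) (coeff≢0⇒∈ p m cm)) none

⊴-degree : ∀ {m t : Monomial n} → expPartition m ⊴ expPartition t → degree m ≡ degree t
⊴-degree {m = m} {t} (tot , _) = trans (sym (sum-expPartition m)) (trans tot (sum-expPartition t))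

level : Monomial n → ℕ
level m = height (expPartition m)

⊴⇒≡⊎level< : ∀ (m t : Monomial n) → expPartition m ⊴ expPartition t → expPartition m ≡ expPartition t ⊎ level m < level t
⊴⇒≡⊎level< m t = ⊴⇒≡⊎height< (trans (length-expPartition m) (sym (length-expPartition t)))

⊴-antisym : ∀ (m t : Monomial n) → expPartition m ⊴ expPartition t → expPartition t ⊴ expPartition m →
  expPartition m ≡ expPartition t
⊴-antisym m t d d′ with ⊴⇒≡⊎level< m t d | ⊴⇒≡⊎level< t m d′
... | inj₁ eq | _       = eq
... | inj₂ _  | inj₁ eq = sym eq
... | inj₂ lt | inj₂ gt = contradiction lt (ℕₚ.<-asym gt)

-- Coordinates on the modules R_λ

part : List ℕ → Poly n → Poly n
part lam = filter (λ t → expPartition (proj₂ t) ≟L lam)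

-- The transpose of `part lam`, acting on functionals (`eval-part`).
cut : List ℕ → (Monomial n → ℚ) → Monomial n → ℚ
cut lam h m with expPartition m ≟L lam
... | yes _ = h m
... | no  _ = 0ℚ

cut-≡ : ∀ lam (h : Monomial n → ℚ) m → expPartition m ≡ lam → cut lam h m ≡ h m
cut-≡ lam h m eq with expPartition m ≟L lam
... | yes _  = refl
... | no  ne = contradiction eq ne

cut-≢ : ∀ lam (h : Monomial n → ℚ) m → expPartition m ≢ lam → cut lam h m ≡ 0ℚ
cut-≢ lam h m ne with expPartition m ≟L lam
... | yes eq = contradiction eq ne
... | no  _  = refl

-- Selecting the terms of one shape commutes with the action; with `average-actM` this makes the
-- components equivariant.
cut-actM : ∀ lam (h : Monomial n → ℚ) τ m → cut lam h (actM τ m) ≡ cut lam (h ∘ actM τ) m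
cut-actM lam h τ m with expPartition m ≟L lam
... | yes eq = cut-≡ lam h (actM τ m) (trans (expPartition-actM τ m) eq)
... | no  ne = cut-≢ lam h (actM τ m) (λ eq → ne (trans (sym (expPartition-actM τ m)) eq))

cut-δ : ∀ lam (m : Monomial n) → expPartition m ≡ lam → ∀ t → cut lam (δ m) t ≡ δ m t
cut-δ lam m eq t with expPartition t ≟L lam
... | yes _  = refl
... | no  ne = sym (δ-≢ m t (λ t≡m → ne (trans (cong expPartition t≡m) eq)))

cut-δ-≢ : ∀ lam (m : Monomial n) → expPartition m ≢ lam → ∀ t → cut lam (δ m) t ≡ 0ℚ
cut-δ-≢ lam m ne t with expPartition t ≟L lam
... | yes eq = δ-≢ m t (λ t≡m → ne (trans (cong expPartition (sym t≡m)) eq))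
... | no  _  = refl

eval-part : ∀ (h : Monomial n → ℚ) lam p → eval h (part lam p) ≡ eval (cut lam h) p
eval-part h lam []            = refl
eval-part h lam ((c , m) ∷ p) with expPartition m ≟L lam
... | yes _ = cong (c ℚ.* h m ℚ.+_) (eval-part h lam p)
... | no  _ = trans (eval-part h lam p) (sym (trans (cong (ℚ._+ eval (cut lam h) p) (ℚₚ.*-zeroʳ c)) (ℚₚ.+-identityˡ _)))

part-terms : ∀ lam (p : Poly n) → Allᴹ (λ t → expPartition t ≡ lam) (part lam p)
part-terms lam p = Allₚ.all-filter (λ t → expPartition (proj₂ t) ≟L lam) p

-- As a functional in `t`, the coordinate at `m` in the basis of descent monomials. It vanishes on
-- the ideal and, if `m` has shape λ, on everything strictly below λ, so it descends to R_λ.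
topCoeff : Monomial n → Monomial n → ℚ
topCoeff m t = eval (δ m) (red t)

topCoeff-basic : ∀ (m : Monomial n) {t} → Basic t → topCoeff m t ≡ δ m t
topCoeff-basic m {t} b = trans (cong (eval (δ m)) (red-basic b)) (eval-mono (δ m) t)

topCoeff-⋬ : ∀ (m t : Monomial n) → ¬ (expPartition m ⊴ expPartition t) → topCoeff m t ≡ 0ℚ
topCoeff-⋬ m t nd = eval-All0 (All.map (λ {x} (_ , d) → δ-≢ m (proj₂ x) (λ eq → nd (subst (λ z → expPartition z ⊴ expPartition t) eq d))) (red-terms t))

minus-red : ∀ (p : Poly n) → InI (p -P lin red p)
minus-red p = InI-resp-≋ (p -P lin red p) (lin (λ t → mono t -P red t) p) expand
  (InI-lin (λ t → mono t -P red t) (All.universal (λ t → red-InI (proj₂ t)) p))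
  where
  expand : p -P lin red p ≋ lin (λ t → mono t -P red t) p
  expand h = begin
    eval h (p -P lin red p)                                ≡⟨ eval-++ h p (-P lin red p) ⟩
    eval h p ℚ.+ eval h (-P lin red p)                     ≡⟨ cong (eval h p ℚ.+_) (trans (eval-· h (ℚ.- 1ℚ) (lin red p)) (cong ((ℚ.- 1ℚ) ℚ.*_) (eval-lin h red p))) ⟩
    eval h p ℚ.+ (ℚ.- 1ℚ) ℚ.* eval (λ t → eval h (red t)) p ≡⟨ cong (eval h p ℚ.+_) (eval-*h (ℚ.- 1ℚ) (λ t → eval h (red t)) p) ⟨
    eval h p ℚ.+ eval (λ t → (ℚ.- 1ℚ) ℚ.* eval h (red t)) p ≡⟨ eval-+h h (λ t → (ℚ.- 1ℚ) ℚ.* eval h (red t)) p ⟨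
    eval (λ t → h t ℚ.+ (ℚ.- 1ℚ) ℚ.* eval h (red t)) p     ≡⟨ eval-cong (λ t → sym (trans (eval-++ h (mono t) (-P red t)) (cong₂ ℚ._+_ (eval-mono h t) (eval-· h (ℚ.- 1ℚ) (red t))))) p ⟩
    eval (λ t → eval h (mono t -P red t)) p                ≡⟨ eval-lin h (λ t → mono t -P red t) p ⟨
    eval h (lin (λ t → mono t -P red t) p)                 ∎
    where open ≡-Reasoning

≋⇒Rel-λ : ∀ lam (p q : Poly n) → p ≋ q → Rel-λ lam p q
≋⇒Rel-λ lam p q eq = [] , (λ m ne → contradiction refl ne) ,
  InI-resp-≋ (p -P q -P []) [] (λ h → trans (eval-- h (p -P q) []) (cong (ℚ._- 0ℚ) (trans (eval-- h p q) (x≡y⇒x-y≡0 (eq h))))) InI-0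

Rel-λ⇒topCoeff : ∀ {lam} (p q : Poly n) → Rel-λ lam p q → ∀ m → expPartition m ≡ lam →
  eval (topCoeff m) p ≡ eval (topCoeff m) q
Rel-λ⇒topCoeff p q (r , strict , inI) m refl = x-y≡0⇒x≡y _ _ (begin
  e p ℚ.- e q            ≡⟨ ℚₚ.+-identityʳ (e p ℚ.- e q) ⟨
  (e p ℚ.- e q) ℚ.- 0ℚ   ≡⟨ cong (λ x → (e p ℚ.- e q) ℚ.- x) (eval-supp0 r vanish) ⟨
  (e p ℚ.- e q) ℚ.- e r  ≡⟨ trans (eval-- (topCoeff m) (p -P q) r) (cong (ℚ._- e r) (eval-- (topCoeff m) p q)) ⟨
  e (p -P q -P r)        ≡⟨ red-ideal (δ m) (p -P q -P r) inI ⟩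
  0ℚ                     ∎)
  where
  open ≡-Reasoning
  e : Poly _ → ℚ
  e = eval (topCoeff m)
  vanish : ∀ t → coeff r t ≢ 0ℚ → topCoeff m t ≡ 0ℚ
  vanish t ne = topCoeff-⋬ m t (λ d → proj₂ (strict t ne) (⊴-antisym t m (proj₁ (strict t ne)) d))

-- The witness is the reduction of `p -P q`: its terms are dominated by `lam`, and those of shape
-- exactly `lam` cancel by hypothesis. Hence the coordinates decide equality in R_λ.
topCoeff⇒Rel-λ : ∀ {lam} (p q : Poly n) → InPDom lam p → InPDom lam q →
  (∀ m → expPartition m ≡ lam → eval (topCoeff m) p ≡ eval (topCoeff m) q) → Rel-λ lam p q
topCoeff⇒Rel-λ {lam = lam} p q dp dq eq = lin red (p -P q) , strict , minus-red (p -P q)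
  where
  support : ∀ t → coeff (p -P q) t ≢ 0ℚ → expPartition t ⊴ lam
  support t ne with coeff--≢0 p q t ne
  ... | inj₁ np = dp t np
  ... | inj₂ nq = dq t nq
  coeff-red : ∀ m → coeff (lin red (p -P q)) m ≡ eval (topCoeff m) (p -P q)
  coeff-red m = trans (coeff-eval (lin red (p -P q)) m) (eval-lin (δ m) red (p -P q))
  strict : InPStrict lam (lin red (p -P q))
  strict m ne with eval≢0⇒∃ (topCoeff m) (p -P q) (λ z → ne (trans (coeff-red m) z))
  ... | t , ct , mt = ⊴-trans {expPartition m} {expPartition t} {lam}
      (proj₂ (coeff≢0⇒All (red-terms t) (λ z → mt (trans (sym (coeff-eval (red t) m)) z)))) (support t ct) ,
    λ e → ne (trans (coeff-red m) (trans (eval-- (topCoeff m) p q) (x≡y⇒x-y≡0 (eq m e))))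

-- The unnormalised average Σ_σ σ ∘ red ∘ σ⁻¹, an equivariant lift of R_n
-- to polynomials.
average : Monomial n → Poly n
average {n} m = concatMap (λ σ → act σ (red (actM (flip σ) m))) (perms n)

avgTerm : (Monomial n → ℚ) → Monomial n → Permutation′ n → ℚ
avgTerm h m σ = eval (h ∘ actM σ) (red (actM (flip σ) m))

eval-average : ∀ (h : Monomial n → ℚ) m → eval h (average m) ≡ Σ⟨ perms n ⟩ (avgTerm h m)
eval-average {n} h m = trans (eval-concatMap h (λ σ → act σ (red (actM (flip σ) m))) (perms n))
  (Σ-cong (λ σ → eval-act h σ (red (actM (flip σ) m))) (perms n))

average-terms : ∀ (m : Monomial n) → Allᴹ (λ t → expPartition t ⊴ expPartition m) (average m)
average-terms {n} m = go (perms n)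
  where
  go : ∀ σs → Allᴹ (λ t → expPartition t ⊴ expPartition m) (concatMap (λ σ → act σ (red (actM (flip σ) m))) σs)
  go []       = []
  go (σ ∷ σs) = Allₚ.++⁺ (Allₚ.map⁺ (All.map
    (λ {t} (_ , d) → subst (_⊴ expPartition m) (sym (expPartition-actM σ (proj₂ t)))
      (subst (expPartition (proj₂ t) ⊴_) (expPartition-actM (flip σ) m) d))
    (red-terms (actM (flip σ) m)))) (go σs)

-- Reindexing by `σ ∘ₚ τ` lets the inner inverse undo `τ`, which then remains only on the outside.
average-actM : ∀ τ (h : Monomial n → ℚ) m → eval h (average (actM τ m)) ≡ eval (h ∘ actM τ) (average m)
average-actM {n} τ h m = begin
  eval h (average (actM τ m))                                  ≡⟨ eval-average h (actM τ m) ⟩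
  Σ⟨ perms n ⟩ (avgTerm h (actM τ m))                          ≡⟨ Σ-postcompose (avgTerm h (actM τ m)) ext τ ⟨
  Σ⟨ perms n ⟩ (λ σ → avgTerm h (actM τ m) (σ ∘ₚ τ))           ≡⟨ Σ-cong shift (perms n) ⟩
  Σ⟨ perms n ⟩ (avgTerm (h ∘ actM τ) m)                        ≡⟨ eval-average (h ∘ actM τ) m ⟨
  eval (h ∘ actM τ) (average m)                                ∎
  where
  open ≡-Reasoning
  ext : Extensional (avgTerm h (actM τ m))
  ext σ ρ eq = trans (cong (λ x → eval (h ∘ actM σ) (red x)) (actM-cong (flip σ) (flip ρ) (flip-cong σ ρ eq) (actM τ m)))
    (eval-cong (λ x → cong h (actM-cong σ ρ eq x)) (red (actM (flip ρ) (actM τ m))))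
  shift : ∀ σ → avgTerm h (actM τ m) (σ ∘ₚ τ) ≡ avgTerm (h ∘ actM τ) m σ
  shift σ = trans
    (cong (λ x → eval (h ∘ actM (σ ∘ₚ τ)) (red x)) (trans (actM-∘ (flip τ) (flip σ) (actM τ m)) (cong (actM (flip σ)) (actM-flipˡ τ m))))
    (eval-cong (λ x → cong h (actM-∘ σ τ x)) (red (actM (flip σ) m)))

average-ideal : ∀ (h : Monomial n → ℚ) p → InI p → eval (λ m → eval h (average m)) p ≡ 0ℚ
average-ideal {n} h p inI = begin
  eval (λ m → eval h (average m)) p                    ≡⟨ eval-cong (eval-average h) p ⟩
  eval (λ m → Σ⟨ perms n ⟩ (avgTerm h m)) p            ≡⟨ Σ-eval (λ σ m → avgTerm h m σ) (perms n) p ⟨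
  Σ⟨ perms n ⟩ (λ σ → eval (λ m → avgTerm h m σ) p)    ≡⟨ Σ-cong zero-term (perms n) ⟩
  Σ⟨ perms n ⟩ (λ σ → 0ℚ)                              ≡⟨ Σ-0 (perms n) ⟩
  0ℚ                                                   ∎
  where
  open ≡-Reasoning
  zero-term : ∀ σ → eval (λ m → avgTerm h m σ) p ≡ 0ℚ
  zero-term σ = trans (sym (eval-act (λ t → eval (h ∘ actM σ) (red t)) (flip σ) p))
    (red-ideal (h ∘ actM σ) (act (flip σ) p) (InI-act (flip σ) p inI))

-- Each summand is congruent to `t` modulo the ideal, where `topCoeff m` vanishes, so each
-- contributes `topCoeff m t`. The cut loses nothing: the discarded terms are strictly below the
-- shape of `m`, and `topCoeff m` is 0 there.
topCoeff-average : ∀ (m t : Monomial n) → expPartition m ≡ expPartition t →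
  eval (cut (expPartition m) (topCoeff m)) (average t) ≡ n!ℚ n ℚ.* topCoeff m t
topCoeff-average {n} m t m~t = trans (eval-average _ t) (trans (Σ-cong term (perms n)) (Σ-const (topCoeff m t) (perms n)))
  where
  term : ∀ σ → avgTerm (cut (expPartition m) (topCoeff m)) t σ ≡ topCoeff m t
  term σ = begin
    eval (cut (expPartition m) (topCoeff m) ∘ actM σ) (red x)  ≡⟨ eval-cong-All (All.map (λ {u} (_ , d) → uncut (proj₂ u) d) (red-terms x)) ⟩
    eval (topCoeff m ∘ actM σ) (red x)                         ≡⟨ x-y≡0⇒x≡y _ _ lift ⟨
    topCoeff m (actM σ x)                                      ≡⟨ cong (topCoeff m) (actM-flipʳ σ t) ⟩
    topCoeff m t                                               ∎
    where
    open ≡-Reasoning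
    x : Monomial n
    x = actM (flip σ) t
    eval-cong-All : ∀ {h h′ : Monomial n → ℚ} {p} → Allᴹ (λ u → h u ≡ h′ u) p → eval h p ≡ eval h′ p
    eval-cong-All []                     = refl
    eval-cong-All (_∷_ {c , u} eq eqs) = cong₂ ℚ._+_ (cong (c ℚ.*_) eq) (eval-cong-All eqs)
    x~m : expPartition x ≡ expPartition m
    x~m = trans (expPartition-actM (flip σ) t) (sym m~t)
    uncut : ∀ u → expPartition u ⊴ expPartition x → cut (expPartition m) (topCoeff m) (actM σ u) ≡ topCoeff m (actM σ u)
    uncut u d with expPartition (actM σ u) ≟L expPartition m
    ... | yes _ = refl
    ... | no ne = sym (topCoeff-⋬ m (actM σ u) (λ d′ → ne (⊴-antisym (actM σ u) m
      (subst (_⊴ expPartition m) (sym (expPartition-actM σ u)) (subst (expPartition u ⊴_) x~m d)) d′)))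
    lift : topCoeff m (actM σ x) ℚ.- eval (topCoeff m ∘ actM σ) (red x) ≡ 0ℚ
    lift = begin
      topCoeff m (actM σ x) ℚ.- eval (topCoeff m ∘ actM σ) (red x)
        ≡⟨ cong (ℚ._- eval (topCoeff m ∘ actM σ) (red x)) (eval-mono (topCoeff m ∘ actM σ) x) ⟨
      eval (topCoeff m ∘ actM σ) (mono x) ℚ.- eval (topCoeff m ∘ actM σ) (red x)
        ≡⟨ eval-- (topCoeff m ∘ actM σ) (mono x) (red x) ⟨
      eval (topCoeff m ∘ actM σ) (mono x -P red x)
        ≡⟨ eval-act (topCoeff m) σ (mono x -P red x) ⟨
      eval (topCoeff m) (act σ (mono x -P red x))
        ≡⟨ red-ideal (δ m) (act σ (mono x -P red x)) (InI-act σ (mono x -P red x) (red-InI x)) ⟩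
      0ℚ ∎

-- Averaging only lowers exponent partitions, so terms of the shape of `m` come from `t` of that
-- shape or of higher level.
topCoeff-average-≢ : ∀ (m t : Monomial n) → expPartition m ≢ expPartition t → ¬ level m < level t →
  eval (cut (expPartition m) (topCoeff m)) (average t) ≡ 0ℚ
topCoeff-average-≢ m t ne nl = eval-All0 (All.map (λ {u} d → vanish (proj₂ u) d) (average-terms t))
  where
  vanish : ∀ u → expPartition u ⊴ expPartition t → cut (expPartition m) (topCoeff m) u ≡ 0ℚ
  vanish u d = cut-≢ (expPartition m) (topCoeff m) u λ u~m → conclude (⊴⇒≡⊎level< m t (subst (_⊴ expPartition t) u~m d))
    where
    conclude : expPartition m ≡ expPartition t ⊎ level m < level t → ⊥
    conclude (inj₁ eq) = ne eq
    conclude (inj₂ lt) = nl lt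

-- The class of `t` in R_λ for its own shape λ, written in descent monomials.
top : Monomial n → Poly n
top t = part (expPartition t) (red t)

top-terms : ∀ (t : Monomial n) → Allᴹ (λ x → Basic x × expPartition x ≡ expPartition t) (top t)
top-terms t = All.zip (Allₚ.filter⁺ (λ x → expPartition (proj₂ x) ≟L expPartition t) (All.map proj₁ (red-terms t)) , part-terms (expPartition t) (red t))

eval-top : ∀ (m t : Monomial n) → eval (δ m) (top t) ≡ cut (expPartition m) (topCoeff m) t
eval-top m t = trans (eval-part (δ m) (expPartition t) (red t)) (by (expPartition t ≟L expPartition m))
  where
  by : Dec (expPartition t ≡ expPartition m) →
    eval (cut (expPartition t) (δ m)) (red t) ≡ cut (expPartition m) (topCoeff m) t
  by (yes eq) = trans (eval-cong (cut-δ (expPartition t) m (sym eq)) (red t)) (sym (cut-≡ (expPartition m) (topCoeff m) t eq))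
  by (no ne)  = trans (eval-cong (cut-δ-≢ (expPartition t) m (ne ∘ sym)) (red t)) (trans (eval-0h (red t)) (sym (cut-≢ (expPartition m) (topCoeff m) t ne)))

-- All components of the image of `t`, each in descent coordinates, collected in one polynomial;
-- this can lose nothing, as the shape of a monomial tells its component.
topAverage : Monomial n → Poly n
topAverage t = lin top (average t)

eval-topAverage : ∀ (m t : Monomial n) → eval (δ m) (topAverage t) ≡ eval (cut (expPartition m) (topCoeff m)) (average t)
eval-topAverage m t = trans (eval-lin (δ m) top (average t)) (eval-cong (eval-top m) (average t))

topAverage-terms : ∀ (m : Monomial n) → Allᴹ (λ t → Basic t × expPartition t ⊴ expPartition m) (topAverage m)
topAverage-terms m = All-lin (All.map (λ {t} d → All.map
  (λ {x} (b , eq) → b , subst (_⊴ expPartition m) (sym eq) d) (top-terms (proj₂ t))) (average-terms m))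

component : List ℕ → Poly n → Poly n
component lam p = part lam (lin average p)

eval-component : ∀ (h : Monomial n → ℚ) lam p → eval h (component lam p) ≡ eval (λ m → eval (cut lam h) (average m)) p
eval-component h lam p = trans (eval-part h lam (lin average p)) (eval-lin (cut lam h) average p)

All⇒InPDom : ∀ {lam} {p : Poly n} → Allᴹ (λ t → expPartition t ≡ lam) p → InPDom lam p
All⇒InPDom {lam = lam} all m ne = subst (_⊴ lam) (sym (coeff≢0⇒All all ne)) (⊴-refl {lam})

component-InPDom : ∀ lam (p : Poly n) → InPDom lam (component lam p)
component-InPDom lam p = All⇒InPDom {p = component lam p} (part-terms lam (lin average p))

decompose : Rk n k → DirectSum n k
decompose p s = component (lamS (proj₁ s)) (proj₁ p) , component-InPDom (lamS (proj₁ s)) (proj₁ p)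

-- Injectivity

index-of : ∀ {m : Monomial n} → Basic m → degree m ≡ k → Σ (Index n k) λ s → expPartition m ≡ lamS (proj₁ s)
index-of {m = m} b deg with basic⇒lamS b
... | S , avoids , eq = (S , avoids , trans (weight-lamS S) (trans (cong sumℕ eq) (trans (sum-expPartition m) deg))) , sym eq

homogeneous-- : ∀ (p q : Poly n) → Homogeneous k p → Homogeneous k q → Homogeneous k (p -P q)
homogeneous-- p q hp hq t ne with coeff--≢0 p q t ne
... | inj₁ np = hp t np
... | inj₂ nq = hq t nq

-- A sum instead of a maximum: any bound can start the descending induction on levels.
levelBound : Poly n → ℕ
levelBound []            = 0
levelBound ((c , m) ∷ p) = level m + levelBound p

level≤bound : ∀ (p : Poly n) m → coeff p m ≢ 0ℚ → level m ≤ levelBound p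
level≤bound p m ne = go p (coeff≢0⇒∈ p m ne)
  where
  go : ∀ p → Any (λ t → proj₂ t ≡ m) p → level m ≤ levelBound p
  go ((c , x) ∷ p) (here refl) = ℕₚ.m≤m+n (level x) (levelBound p)
  go ((c , x) ∷ p) (there x∈)  = ℕₚ.≤-trans (go p x∈) (ℕₚ.m≤n+m (levelBound p) (level x))

-- The difference `v` is congruent to its reduction `u`, so it suffices that `u` is zero. Equality
-- of the components says that `Φ m` vanishes on `v`, hence on `u`, because averaging kills the
-- ideal.
decompose-injective : ∀ (p q : Rk n k) → pr (decompose p) ∼⊕ pr (decompose q) → proj₁ p ∼I proj₁ q
decompose-injective {n} {k} (p , hp) (q , hq) rel = InI-resp-≋ v (v -P u)
  (λ h → sym (trans (eval-- h v u) (trans (cong (λ x → eval h v ℚ.- x) (≈P⇒≋ {p = u} {[]} u≈0 h)) (ℚₚ.+-identityʳ (eval h v)))))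
  (minus-red v)
  where
  v u : Poly n
  v = p -P q
  u = lin red v
  u-terms : ∀ m → coeff u m ≢ 0ℚ → Basic m × degree m ≡ k
  u-terms m ne with eval≢0⇒∃ (topCoeff m) v (λ z → ne (trans (coeff-eval u m) (trans (eval-lin (δ m) red v) z)))
  ... | t , ct , mt with coeff≢0⇒All (red-terms t) (λ z → mt (trans (sym (coeff-eval (red t) m)) z))
  ...   | b , d = b , trans (⊴-degree {m = m} {t} d) (homogeneous-- p q hp hq t ct)
  Φ : Monomial n → Monomial n → ℚ
  Φ m t = eval (cut (expPartition m) (topCoeff m)) (average t)
  Φ-zero : ∀ m (s : Index n k) → expPartition m ≡ lamS (proj₁ s) → eval (Φ m) u ≡ 0ℚ
  Φ-zero m s eq = begin
    eval (Φ m) u          ≡⟨ x-y≡0⇒x≡y _ _ (trans (sym (eval-- (Φ m) v u)) (average-ideal _ (v -P u) (minus-red v))) ⟨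
    eval (Φ m) v          ≡⟨ eval-- (Φ m) p q ⟩
    eval (Φ m) p ℚ.- eval (Φ m) q  ≡⟨ x≡y⇒x-y≡0 same ⟩
    0ℚ                    ∎
    where
    open ≡-Reasoning
    asΦ : ∀ x → eval (topCoeff m) (component (lamS (proj₁ s)) x) ≡ eval (Φ m) x
    asΦ x = trans (eval-component (topCoeff m) (lamS (proj₁ s)) x)
      (cong (λ lam → eval (λ t → eval (cut lam (topCoeff m)) (average t)) x) (sym eq))
    same : eval (Φ m) p ≡ eval (Φ m) q
    same = trans (sym (asΦ p)) (trans (Rel-λ⇒topCoeff (component (lamS (proj₁ s)) p) (component (lamS (proj₁ s)) q) (rel s) m eq) (asΦ q))
  -- From the dominant partitions downwards: once the coefficients of u above
  -- m vanish, Φ m only sees n! times the coefficient of m.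
  Zero : ℕ → Set
  Zero j = ∀ m → j ≤ level m → coeff u m ≡ 0ℚ
  descend : ∀ j → Zero (suc j) → Zero j
  descend j above m j≤ with coeff u m ℚₚ.≟ 0ℚ
  ... | yes eq = eq
  ... | no ne  = contradiction (*-cancelˡ (n!ℚ≢0 n) (begin
    n!ℚ n ℚ.* coeff u m                  ≡⟨ cong (n!ℚ n ℚ.*_) (coeff-eval u m) ⟩
    n!ℚ n ℚ.* eval (δ m) u               ≡⟨ eval-*h (n!ℚ n) (δ m) u ⟨
    eval (λ t → n!ℚ n ℚ.* δ m t) u       ≡⟨ eval-supp u diagonal ⟨
    eval (Φ m) u                         ≡⟨ Φ-zero m (proj₁ found) (proj₂ found) ⟩
    0ℚ                                   ≡⟨ ℚₚ.*-zeroʳ (n!ℚ n) ⟨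
    n!ℚ n ℚ.* 0ℚ                         ∎)) ne
    where
    open ≡-Reasoning
    -- `Φ m` is known to vanish only at shapes that index a summand; a nonzero coefficient makes `m`
    -- basic of degree `k`, which yields the index.
    found : Σ (Index n k) λ s → expPartition m ≡ lamS (proj₁ s)
    found = index-of (proj₁ (u-terms m ne)) (proj₂ (u-terms m ne))
    diagonal : ∀ t → coeff u t ≢ 0ℚ → Φ m t ≡ n!ℚ n ℚ.* δ m t
    diagonal t ct with expPartition m ≟L expPartition t
    ... | yes eq  = trans (topCoeff-average m t eq) (cong (n!ℚ n ℚ.*_) (topCoeff-basic m (proj₁ (u-terms t ct))))
    ... | no m≁t = trans (topCoeff-average-≢ m t m≁t (λ lt → ct (above t (ℕₚ.≤-<-trans j≤ lt))))
      (sym (trans (cong (n!ℚ n ℚ.*_) (δ-≢ m t (λ eq → m≁t (cong expPartition (sym eq))))) (ℚₚ.*-zeroʳ (n!ℚ n))))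
  from : ∀ j → Zero j → Zero 0
  from zero    z = z
  from (suc j) z = from j (descend j z)
  u≈0 : u ≈P []
  u≈0 m = from (suc (levelBound u)) top-zero m z≤n
    where
    top-zero : Zero (suc (levelBound u))
    top-zero m lt with coeff u m ℚₚ.≟ 0ℚ
    ... | yes eq = eq
    ... | no ne  = contradiction (level≤bound u m ne) (ℕₚ.<⇒≱ lt)

-- Surjectivity

Preimage : ℕ → Poly n → Set
Preimage {n} k p = Σ (Poly n) λ u → Allᴹ (λ t → degree t ≡ k) u × (∀ h → eval (λ t → eval h (topAverage t)) u ≡ eval h p)

preimage-list : ∀ {p : Poly n} → Allᴹ (λ t → Preimage k (mono t)) p → Preimage k p
preimage-list []                                    = [] , [] , λ h → refl
preimage-list (_∷_ {c , m} {p} (u , du , eu) pres) with preimage-list pres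
... | w , dw , ew = (c ·P u) +P w , Allₚ.++⁺ (All-· c du) dw , λ h →
  trans (eval-++ _ (c ·P u) w) (cong₂ ℚ._+_ (trans (eval-· _ c u) (cong (c ℚ.*_) (trans (eu h) (eval-mono h m)))) (ew h))

-- `topAverage m` is n! times `m` plus basic terms of lower level and the same degree. Subtracting
-- preimages of those terms from `m` and dividing by n! gives a preimage of `m`.
preimage-mono : ∀ (m : Monomial n) → Basic m → Preimage (degree m) (mono m)
preimage-mono {n} = measure-rec level _ (λ m rec b → step m b (λ t bt lt → rec t lt bt))
  where
  step : ∀ m → Basic m → (∀ t → Basic t → level t < level m → Preimage (degree t) (mono t)) → Preimage (degree m) (mono m)
  step m b rec = solve (preimage-list (All.map (λ {t} (bt , d , lt) →
      subst (λ d → Preimage d (mono (proj₂ t))) (⊴-degree {m = proj₂ t} {m} d) (rec (proj₂ t) bt lt)) below-terms))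
    where
    below : Poly n
    below = filter (λ t → ¬? (expPartition (proj₂ t) ≟L expPartition m)) (topAverage m)
    below-terms : Allᴹ (λ t → Basic t × expPartition t ⊴ expPartition m × level t < level m) below
    below-terms = All.zipWith (λ {t} → pick (proj₂ t))
      ( Allₚ.all-filter (λ t → ¬? (expPartition (proj₂ t) ≟L expPartition m)) (topAverage m)
      , Allₚ.filter⁺ (λ t → ¬? (expPartition (proj₂ t) ≟L expPartition m)) (topAverage-terms m))
      where
      pick : ∀ t → expPartition t ≢ expPartition m × (Basic t × expPartition t ⊴ expPartition m) →
        Basic t × expPartition t ⊴ expPartition m × level t < level m
      pick t (ne , bt , d) with ⊴⇒≡⊎level< t m d
      ... | inj₁ eq = contradiction eq ne
      ... | inj₂ lt = bt , d , lt
    split : ∀ (h : Monomial n → ℚ) p → eval h p ≡ eval h (part (expPartition m) p) ℚ.+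
      eval h (filter (λ t → ¬? (expPartition (proj₂ t) ≟L expPartition m)) p)
    split h []            = refl
    split h ((c , t) ∷ p) with expPartition t ≟L expPartition m
    ... | yes _ = trans (cong (c ℚ.* h t ℚ.+_) (split h p)) (sym (ℚₚ.+-assoc (c ℚ.* h t) _ _))
    ... | no  _ = trans (cong (c ℚ.* h t ℚ.+_) (split h p)) (+-leftComm (c ℚ.* h t) (eval h (part (expPartition m) p)) _)
    -- For `x` of the shape of `m` the coefficient is n! times `topCoeff x m`, and this is a
    -- Kronecker delta because `m` is basic.
    diagonal : part (expPartition m) (topAverage m) ≋ n!ℚ n ·P mono m
    diagonal = ≈P⇒≋ {p = part (expPartition m) (topAverage m)} {n!ℚ n ·P mono m} λ x →
      trans (coeff-eval (part (expPartition m) (topAverage m)) x)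
        (trans (trans (eval-part (δ x) (expPartition m) (topAverage m)) (by x (expPartition x ≟L expPartition m)))
          (sym (trans (coeff-eval (n!ℚ n ·P mono m) x) (trans (eval-· (δ x) (n!ℚ n) (mono m)) (cong (n!ℚ n ℚ.*_) (eval-mono (δ x) m))))))
      where
      by : ∀ x → Dec (expPartition x ≡ expPartition m) → eval (cut (expPartition m) (δ x)) (topAverage m) ≡ n!ℚ n ℚ.* δ x m
      by x (yes eq) = trans (eval-cong (cut-δ (expPartition m) x eq) (topAverage m)) (trans (eval-topAverage x m)
        (trans (topCoeff-average x m eq) (cong (n!ℚ n ℚ.*_) (topCoeff-basic x b))))
      by x (no ne) = trans (eval-cong (cut-δ-≢ (expPartition m) x ne) (topAverage m)) (trans (eval-0h (topAverage m))
        (sym (trans (cong (n!ℚ n ℚ.*_) (δ-≢ x m (λ eq → ne (cong expPartition (sym eq))))) (ℚₚ.*-zeroʳ (n!ℚ n)))))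
    solve : Preimage (degree m) below → Preimage (degree m) (mono m)
    solve (w , dw , ew) = c⁻¹ ·P (mono m -P w) , All-· c⁻¹ (refl ∷ All-· (ℚ.- 1ℚ) dw) , λ h → begin
      eval (T h) (c⁻¹ ·P (mono m -P w))                       ≡⟨ eval-· (T h) c⁻¹ (mono m -P w) ⟩
      c⁻¹ ℚ.* eval (T h) (mono m -P w)                        ≡⟨ cong (c⁻¹ ℚ.*_) (trans (eval-- (T h) (mono m) w) (cong₂ ℚ._-_ (eval-mono (T h) m) (ew h))) ⟩
      c⁻¹ ℚ.* (T h m ℚ.- eval h below)                        ≡⟨ cong (λ x → c⁻¹ ℚ.* (x ℚ.- eval h below)) (trans (split h (topAverage m)) (cong (ℚ._+ eval h below) (trans (diagonal h) (eval-· h (n!ℚ n) (mono m))))) ⟩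
      c⁻¹ ℚ.* ((n!ℚ n ℚ.* eval h (mono m) ℚ.+ eval h below) ℚ.- eval h below)  ≡⟨ cong (c⁻¹ ℚ.*_) (cancel (n!ℚ n ℚ.* eval h (mono m)) (eval h below)) ⟩
      c⁻¹ ℚ.* (n!ℚ n ℚ.* eval h (mono m))                     ≡⟨ inv-* (n!ℚ n) (n!ℚ≢0 n) (eval h (mono m)) ⟩
      eval h (mono m)                                         ∎
      where
      open ≡-Reasoning
      c⁻¹ : ℚ
      c⁻¹ = inv (n!ℚ n) (n!ℚ≢0 n)
      T : (Monomial n → ℚ) → Monomial n → ℚ
      T h t = eval h (topAverage t)
      cancel : ∀ x y → (x ℚ.+ y) ℚ.- y ≡ x
      cancel x y = trans (ℚₚ.+-assoc x y (ℚ.- y)) (trans (cong (x ℚ.+_) (ℚₚ.+-inverseʳ y)) (ℚₚ.+-identityʳ x))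

subsets : ∀ n → List (Subset n)
subsets zero    = [] ∷ []
subsets (suc n) = map (true ∷_) (subsets n) ++ map (false ∷_) (subsets n)

Σ-subsets-single : ∀ (f : Subset n → ℚ) S → (∀ T → T ≢ S → f T ≡ 0ℚ) → Σ⟨ subsets n ⟩ f ≡ f S
Σ-subsets-single {zero}  f []      z = ℚₚ.+-identityʳ (f [])
Σ-subsets-single {suc n} f (b ∷ S) z = trans (Σ-++ f (map (true ∷_) (subsets n)) (map (false ∷_) (subsets n)))
  (trans (cong₂ ℚ._+_ (Σ-map f (true ∷_) (subsets n)) (Σ-map f (false ∷_) (subsets n))) (by b z))
  where
  same : ∀ b → (∀ T → T ≢ b ∷ S → f T ≡ 0ℚ) → Σ⟨ subsets n ⟩ (λ T → f (b ∷ T)) ≡ f (b ∷ S)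
  same b z = Σ-subsets-single (λ T → f (b ∷ T)) S (λ T ne → z (b ∷ T) (λ { refl → ne refl }))
  other : ∀ b c → c ≢ b → (∀ T → T ≢ b ∷ S → f T ≡ 0ℚ) → Σ⟨ subsets n ⟩ (λ T → f (c ∷ T)) ≡ 0ℚ
  other b c c≢b z = trans (Σ-cong (λ T → z (c ∷ T) (λ { refl → c≢b refl })) (subsets n)) (Σ-0 (subsets n))
  by : ∀ b → (∀ T → T ≢ b ∷ S → f T ≡ 0ℚ) →
    Σ⟨ subsets n ⟩ (λ T → f (true ∷ T)) ℚ.+ Σ⟨ subsets n ⟩ (λ T → f (false ∷ T)) ≡ f (b ∷ S)
  by true  z = trans (cong₂ ℚ._+_ (same true z) (other true false (λ ()) z)) (ℚₚ.+-identityʳ (f (true ∷ S)))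
  by false z = trans (cong₂ ℚ._+_ (other false true (λ ()) z) (same false z)) (ℚₚ.+-identityˡ (f (false ∷ S)))

avoidsLast? : ∀ (S : Subset n) → Dec (AvoidsLast S)
avoidsLast? []          = yes tt
avoidsLast? (b ∷ [])    = b Boolₚ.≟ false
avoidsLast? (b ∷ c ∷ S) = avoidsLast? (c ∷ S)

-- An element of the direct sum may depend on the proofs inside an index; irrelevance identifies its
-- values at the decided and at the given proof.
avoidsLast-irrelevant : ∀ (S : Subset n) (a b : AvoidsLast S) → a ≡ b
avoidsLast-irrelevant []          a b = refl
avoidsLast-irrelevant (x ∷ [])    a b = Decidable⇒UIP.≡-irrelevant Boolₚ._≟_ a b
avoidsLast-irrelevant (x ∷ c ∷ S) a b = avoidsLast-irrelevant (c ∷ S) a b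

index? : ∀ k (S : Subset n) → Dec (AvoidsLast S × weight S ≡ k)
index? k S = avoidsLast? S ×-dec (weight S ℕ.≟ k)

-- The parts of shape λ_S of all entries of `y` are glued into one `target` of degree `k`. Since S
-- is determined by λ_S, cutting by shape recovers each entry, so a preimage of the descent
-- coordinates of `target` suffices.
decompose-surjective : ∀ (y : DirectSum n k) → Σ (Rk n k) λ p → pr (decompose p) ∼⊕ pr y
decompose-surjective {n} {k} y = (u , λ m ne → coeff≢0⇒All u-degree ne) , λ s →
  topCoeff⇒Rel-λ (component (lamS (proj₁ s)) u) (proj₁ (y s)) (component-InPDom (lamS (proj₁ s)) u) (proj₂ (y s)) (matches s)
  where
  summand : ∀ S → Dec (AvoidsLast S × weight S ≡ k) → Poly n
  summand S (yes i) = part (lamS S) (proj₁ (y (S , i)))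
  summand S (no _)  = []
  target : Poly n
  target = concatMap (λ S → summand S (index? k S)) (subsets n)
  target-degree : Allᴹ (λ t → degree t ≡ k) target
  target-degree = go (subsets n)
    where
    summand-degree : ∀ S d → Allᴹ (λ t → degree t ≡ k) (summand S d)
    summand-degree S (no _)  = []
    summand-degree S (yes (a , w)) = All.map (λ {t} eq → trans (sym (sum-expPartition (proj₂ t)))
      (trans (cong sumℕ eq) (trans (sym (weight-lamS S)) w))) (part-terms (lamS S) (proj₁ (y (S , a , w))))
    go : ∀ Ss → Allᴹ (λ t → degree t ≡ k) (concatMap (λ S → summand S (index? k S)) Ss)
    go []       = []
    go (S ∷ Ss) = Allₚ.++⁺ (summand-degree S (index? k S)) (go Ss)
  pre : Preimage k (lin top target)
  pre = preimage-list (All-lin (All.map (λ {t} deg → All.map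
    (λ {x} (b , eq) → subst (λ d → Preimage d (mono (proj₂ x)))
      (trans (⊴-degree {m = proj₂ x} {proj₂ t} (subst (_⊴ expPartition (proj₂ t)) (sym eq) (⊴-refl {expPartition (proj₂ t)}))) deg)
      (preimage-mono (proj₂ x) b)) (top-terms (proj₂ t))) target-degree))
  u : Poly n
  u = proj₁ pre
  u-degree : Allᴹ (λ t → degree t ≡ k) u
  u-degree = proj₁ (proj₂ pre)
  matches : ∀ (s : Index n k) m → expPartition m ≡ lamS (proj₁ s) →
    eval (topCoeff m) (component (lamS (proj₁ s)) u) ≡ eval (topCoeff m) (proj₁ (y s))
  matches s@(S , i@(a , w)) m m~S = begin
    eval (topCoeff m) (component (lamS S) u)                                    ≡⟨ eval-component (topCoeff m) (lamS S) u ⟩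
    eval (λ t → eval (cut (lamS S) (topCoeff m)) (average t)) u                 ≡⟨ cong (λ lam → eval (λ t → eval (cut lam (topCoeff m)) (average t)) u) m~S ⟨
    eval (λ t → eval (cut (expPartition m) (topCoeff m)) (average t)) u         ≡⟨ eval-cong (eval-topAverage m) u ⟨
    eval (λ t → eval (δ m) (topAverage t)) u                                    ≡⟨ proj₂ (proj₂ pre) (δ m) ⟩
    eval (δ m) (lin top target)                                                 ≡⟨ trans (eval-lin (δ m) top target) (eval-cong (eval-top m) target) ⟩
    eval (cut (expPartition m) (topCoeff m)) target                             ≡⟨ cong (λ lam → eval (cut lam (topCoeff m)) target) m~S ⟩
    eval (cut (lamS S) (topCoeff m)) target                                     ≡⟨ eval-concatMap _ (λ T → summand T (index? k T)) (subsets n) ⟩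
    Σ⟨ subsets n ⟩ (λ T → eval (cut (lamS S) (topCoeff m)) (summand T (index? k T)))  ≡⟨ Σ-subsets-single _ S (λ T ne → others T ne (index? k T)) ⟩
    eval (cut (lamS S) (topCoeff m)) (summand S (index? k S))                   ≡⟨ own (index? k S) ⟩
    eval (topCoeff m) (proj₁ (y s))                                             ∎
    where
    open ≡-Reasoning
    others : ∀ T → T ≢ S → ∀ d → eval (cut (lamS S) (topCoeff m)) (summand T d) ≡ 0ℚ
    others T ne (no _)  = refl
    others T ne (yes j) = eval-All0 (All.map (λ {t} eq → cut-≢ (lamS S) (topCoeff m) (proj₂ t) (λ eq′ → ne (lamS-injective T S (trans (sym eq) eq′))))
      (part-terms (lamS T) (proj₁ (y (T , j)))))
    own : ∀ d → eval (cut (lamS S) (topCoeff m)) (summand S d) ≡ eval (topCoeff m) (proj₁ (y s))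
    own (no ni) = contradiction i ni
    own (yes (a′ , w′)) with refl ← avoidsLast-irrelevant S a a′ | refl ← ℕₚ.≡-irrelevant w w′ =
      trans (eval-part (cut (lamS S) (topCoeff m)) (lamS S) (proj₁ (y s))) (eval-supp (proj₁ (y s)) uncut)
      where
      -- Terms of `y s` strictly below λ_S were dropped from `target`, but `topCoeff m` vanishes on
      -- them.
      uncut : ∀ t → coeff (proj₁ (y s)) t ≢ 0ℚ → cut (lamS S) (cut (lamS S) (topCoeff m)) t ≡ topCoeff m t
      uncut t ct = by (expPartition t ≟L lamS S)
        where
        by : Dec (expPartition t ≡ lamS S) → cut (lamS S) (cut (lamS S) (topCoeff m)) t ≡ topCoeff m t
        by (yes eq) = trans (cut-≡ (lamS S) (cut (lamS S) (topCoeff m)) t eq) (cut-≡ (lamS S) (topCoeff m) t eq)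
        by (no ne)  = trans (cut-≢ (lamS S) (cut (lamS S) (topCoeff m)) t ne) (sym (topCoeff-⋬ m t (λ d → ne
          (trans (⊴-antisym t m (subst (expPartition t ⊴_) (sym m~S) (proj₂ (y s) t ct)) d) m~S))))

theorem3p12 : (n k : ℕ) → k ≤ n C 2 → Rk≅⊕Rλ n k
theorem3p12 n k _ = decompose , record
  -- The first four laws hold as equalities of polynomials, before any quotient: averaging kills the
  -- ideal outright and commutes with the action.
  { well-defined = λ p q p∼q s → ≋⇒Rel-λ (lam s) (F s (proj₁ p)) (F s (proj₁ q)) λ h →
      trans (eval-component h (lam s) (proj₁ p)) (trans
        (x-y≡0⇒x≡y _ _ (trans (sym (eval-- (weights h s) (proj₁ p) (proj₁ q))) (average-ideal (cut (lam s) h) (proj₁ p -P proj₁ q) p∼q)))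
        (sym (eval-component h (lam s) (proj₁ q))))
  ; additive = λ p q r r≈ s → ≋⇒Rel-λ (lam s) (F s (proj₁ r)) (F s (proj₁ p) +P F s (proj₁ q)) λ h →
      trans (eval-component h (lam s) (proj₁ r)) (trans (≈P⇒≋ {p = proj₁ r} {proj₁ p +P proj₁ q} r≈ (weights h s))
        (trans (eval-++ (weights h s) (proj₁ p) (proj₁ q)) (sym (trans (eval-++ h (F s (proj₁ p)) (F s (proj₁ q)))
          (cong₂ ℚ._+_ (eval-component h (lam s) (proj₁ p)) (eval-component h (lam s) (proj₁ q)))))))
  ; homogeneous = λ c p r r≈ s → ≋⇒Rel-λ (lam s) (F s (proj₁ r)) (c ·P F s (proj₁ p)) λ h →
      trans (eval-component h (lam s) (proj₁ r)) (trans (≈P⇒≋ {p = proj₁ r} {c ·P proj₁ p} r≈ (weights h s))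
        (trans (eval-· (weights h s) c (proj₁ p)) (sym (trans (eval-· h c (F s (proj₁ p)))
          (cong (c ℚ.*_) (eval-component h (lam s) (proj₁ p)))))))
  ; equivariant = λ τ p r r≈ s → ≋⇒Rel-λ (lam s) (F s (proj₁ r)) (act τ (F s (proj₁ p))) λ h →
      trans (eval-component h (lam s) (proj₁ r)) (trans (≈P⇒≋ {p = proj₁ r} {act τ (proj₁ p)} r≈ (weights h s))
        (trans (eval-act (weights h s) τ (proj₁ p)) (trans
          (eval-cong (λ m → trans (average-actM τ (cut (lam s) h) m) (eval-cong (cut-actM (lam s) h τ) (average m))) (proj₁ p))
          (sym (trans (eval-act h τ (F s (proj₁ p))) (eval-component (h ∘ actM τ) (lam s) (proj₁ p)))))))
  ; injective  = decompose-injective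
  ; surjective = decompose-surjective
  }
  where
  lam : Index n k → List ℕ
  lam s = lamS (proj₁ s)
  F : Index n k → Poly n → Poly n
  F s = component (lam s)
  weights : (Monomial n → ℚ) → Index n k → Monomial n → ℚ
  weights h s m = eval (cut (lam s) h) (average m)
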